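{- Let $T=\{1243,3142,3412\}$. Then $$F_T(x)=\frac{1-9x+30x^2-44x^3+27x^4-7x^5}{(1-3x)(1-x)(1-3x+x^2)^2}.$$
   Context: $S_n(T)$ denotes the set of permutations $\pi$ of $[n]=\{1,\dots,n\}$ (one-line notation) that avoid every pattern $\tau\in T$, i.e. no subsequence of $\pi$ is order-isomorphic to $\tau$. $F_T(x)=\sum_{n\ge 0}|S_n(T)|x^n$, a formal power series, with $|S_0(T)|=1$. -}

module Defs where

open import Data.Integer.Properties using (+-*-semiring)
open import Algebra.Properties.Semiring.Sum +-*-semiring using (sum-syntax)
open import Data.Fin.Base as Fin using (Fin; toℕ)
import Data.Fin.Properties as Fin
open import Data.Integer.Base using (ℤ; +_; _*_; 0ℤ)
open import Data.List.Base
  using (List; []; _∷_; allFin; cartesianProductWith; filter; length)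
  renaming (lookup to lookupᴸ)
open import Data.List.Membership.Propositional using (_∈_; lose)
open import Data.List.Membership.Propositional.Properties
  using (∈-allFin; ∈-cartesianProductWith⁺; ∈-filter⁺; ∈-filter⁻)
open import Data.List.Relation.Unary.All as All using (All; [])
open import Data.List.Relation.Unary.AllPairs using ([]; _∷_)
open import Data.List.Relation.Unary.Any as Any using (here)
open import Data.List.Relation.Unary.Unique.Propositional using (Unique)
open import Data.List.Relation.Unary.Unique.Propositional.Properties
  using (allFin⁺; cartesianProductWith⁺; filter⁺)
open import Data.Nat.Base as ℕ using (ℕ; zero; suc; _∸_)
import Data.Nat.Properties as ℕ
open import Data.Product.Base using (_×_; _,_; proj₁; proj₂; ∃; uncurry)
open import Data.Vec.Base using (Vec; []; _∷_; lookup; map)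
open import Data.Vec.Properties using (∷-injective)
open import Function.Base using (_∘_)
open import Function.Bundles using (_⇔_; mk⇔; Equivalence)
open import Function.Definitions using (Bijective)
open import Relation.Binary.PropositionalEquality using (_≡_; refl)
open import Relation.Nullary using (¬_; Dec)
open import Relation.Nullary.Decidable using (map′; ¬?; _×-dec_; _→-dec_)

words : ∀ n k → List (Vec (Fin n) k)
words n zero    = [] ∷ []
words n (suc k) = cartesianProductWith _∷_ (allFin n) (words n k)

words-complete : ∀ {n k} (w : Vec (Fin n) k) → w ∈ words n k
words-complete []      = here refl
words-complete (x ∷ w) = ∈-cartesianProductWith⁺ _∷_ (∈-allFin x) (words-complete w)

words-unique : ∀ n k → Unique (words n k)
words-unique n zero    = [] ∷ []
words-unique n (suc k) =
  cartesianProductWith⁺ _∷_ ∷-injective (allFin⁺ n) (words-unique n k)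

-- One-line notation, with the letters 0, …, n−1 in place of 1, …, n.
IsPermutation : ∀ {n} → Vec (Fin n) n → Set
IsPermutation π = Bijective _≡_ _≡_ (lookup π)

isPermutation? : ∀ {n} (π : Vec (Fin n) n) → Dec (IsPermutation π)
isPermutation? π =
  map′ (λ f {i} {j} → f i j) (λ f i j → f {i} {j})
    (Fin.all? λ i → Fin.all? λ j → lookup π i Fin.≟ lookup π j →-dec i Fin.≟ j)
  ×-dec
  map′ (λ f y → proj₁ (f y) , λ { refl → proj₂ (f y) })
       (λ f y → proj₁ (f y) , proj₂ (f y) refl)
    (Fin.all? λ y → Fin.any? λ i → lookup π i Fin.≟ y)

Increasing : ∀ {n k} → Vec (Fin n) k → Set
Increasing p = ∀ i j → i Fin.< j → lookup p i Fin.< lookup p j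

-- A pattern τ is given in one-line notation. Only the relative order of its
-- entries matters, so it may be written with the letters 1, …, k.
OrderIsomorphic : ∀ {n} (τ : List ℕ) → Vec (Fin n) (length τ) → Set
OrderIsomorphic τ w =
  ∀ i j → lookup w i Fin.< lookup w j ⇔ lookupᴸ τ i ℕ.< lookupᴸ τ j

-- The vector p lists the positions of the subsequence.
Occurrence : ∀ {n m} (τ : List ℕ) → Vec (Fin n) m → Vec (Fin m) (length τ) → Set
Occurrence τ π p = Increasing p × OrderIsomorphic τ (map (lookup π) p)

Contains : ∀ {n m} → Vec (Fin n) m → List ℕ → Set
Contains π τ = ∃ (Occurrence τ π)

Avoids : ∀ {n m} → Vec (Fin n) m → List (List ℕ) → Set
Avoids π T = All (λ τ → ¬ Contains π τ) T

_⇔-dec_ : ∀ {A B : Set} → Dec A → Dec B → Dec (A ⇔ B)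
a? ⇔-dec b? = map′ (uncurry mk⇔) (λ e → Equivalence.to e , Equivalence.from e)
  ((a? →-dec b?) ×-dec (b? →-dec a?))

contains? : ∀ {n m} (π : Vec (Fin n) m) τ → Dec (Contains π τ)
contains? {m = m} π τ =
  map′ Any.satisfied (λ (p , occ) → lose (words-complete p) occ)
    (Any.any? occurrence? (words m (length τ)))
  where
  occurrence? : ∀ p → Dec (Occurrence τ π p)
  occurrence? p =
    (Fin.all? λ i → Fin.all? λ j → i Fin.<? j →-dec lookup p i Fin.<? lookup p j)
    ×-dec
    (Fin.all? λ i → Fin.all? λ j →
      (lookup w i Fin.<? lookup w j) ⇔-dec (lookupᴸ τ i ℕ.<? lookupᴸ τ j))
    where w = map (lookup π) p

avoids? : ∀ {n m} (π : Vec (Fin n) m) T → Dec (Avoids π T)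
avoids? π = All.all? (λ τ → ¬? (contains? π τ))

S : (n : ℕ) → List (List ℕ) → List (Vec (Fin n) n)
S n T = filter (λ π → isPermutation? π ×-dec avoids? π T) (words n n)

-- S n T lists the T-avoiding permutations of length n without repetition,
-- so its length is their number.
∈-S : ∀ {n} T (π : Vec (Fin n) n) → π ∈ S n T ⇔ (IsPermutation π × Avoids π T)
∈-S T π = mk⇔ (proj₂ ∘ ∈-filter⁻ P? {xs = words _ _}) (∈-filter⁺ P? (words-complete π))
  where P? = λ π → isPermutation? π ×-dec avoids? π T

S-unique : ∀ n T → Unique (S n T)
S-unique n T = filter⁺ (λ π → isPermutation? π ×-dec avoids? π T) (words-unique n n)

-- A formal power series over ℤ, as its sequence of coefficients.
PowerSeries : Set
PowerSeries = ℕ → ℤ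

infixl 7 _⊛_

_⊛_ : PowerSeries → PowerSeries → PowerSeries
(f ⊛ g) n = ∑[ i < suc n ] (f (toℕ i) * g (n ∸ toℕ i))

-- Coefficients in order of increasing degree.
poly : List ℤ → PowerSeries
poly []       _       = 0ℤ
poly (a ∷ as) zero    = a
poly (a ∷ as) (suc n) = poly as n

F : List (List ℕ) → PowerSeries
F T n = + length (S n T)

{-# OPTIONS --safe #-}

-- Build permutations by inserting the maximum into a gap. The gaps where no forbidden pattern
-- appears split, by how they interact with the ascents of the word, into a gap α, a gaps below α
-- and e + c gaps above α, and (a , c , e) determines the labels of the children. Before the
-- first ascent all gaps are free; the insertion creating it gives the label (a , c , 0) with
-- a, c ≥ 1. So F = 1/(1-x) + Σ_{a,c≥1} xᵃ⁺ᶜ Pₐ꜀₀, where Pₐ꜀ₑ and Sₐ꜀ₑ count the descendants of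
-- the two kinds (plain and star) of labels. The rules give (1-2x) Sₑ₊₁ = (1-x) Sₑ and
-- (1-3x+x²) Pₑ = (1-x)(1-2x) Sₑ, while Σ_{a≥0,c≥1} xᵃ⁺ᶜ⁻¹ Sₐ꜀₀ = 1/((1-x)(1-3x)), whose part
-- a = 0 is 1/(1-3x+x²).
module Submission where

open import Defs
import Data.Integer.Properties as ℤ
open import Algebra.Properties.Semiring.Sum ℤ.+-*-semiring
  using (sum; sum-init-last; sum-cong-≗; sum-replicate-zero)
open import Data.Fin.Base as Fin using (Fin; zero; suc; fromℕ; inject₁; lower₁; punchIn; toℕ)
import Data.Fin.Properties as Fin
open import Data.Fin.Relation.Unary.Top using (view; ‵fromℕ; ‵inject₁)
open import Data.Integer.Base using (ℤ; +_; -_; _+_; _*_; _-_; 0ℤ; 1ℤ)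
open import Data.Integer.Tactic.RingSolver using (solve-∀)
open import Data.List.Base
  using (List; []; _∷_; _++_; allFin; applyUpTo; cartesianProduct; downFrom; filter; length; map; upTo)
  renaming (lookup to lookupᴸ)
open import Data.List.Membership.Propositional using (_∈_)
open import Data.List.Membership.Propositional.Properties
  using ( ∈-++⁺ˡ; ∈-++⁺ʳ; ∈-++⁻; ∈-allFin; ∈-applyUpTo⁺; ∈-applyUpTo⁻; ∈-cartesianProduct⁺
        ; ∈-cartesianProduct⁻; ∈-downFrom⁺; ∈-downFrom⁻; ∈-filter⁺; ∈-filter⁻; ∈-map⁺; ∈-map⁻
        ; ∈-upTo⁺; ∈-upTo⁻)
open import Data.List.Membership.Propositional.Properties.WithK using (unique∧set⇒bag)
open import Data.List.Properties using (++-assoc; length-applyUpTo; length-downFrom; length-map; map-++)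
open import Data.List.Relation.Binary.BagAndSetEquality using (∼bag⇒↭)
open import Data.List.Relation.Binary.Permutation.Propositional as ↭ using (_↭_)
open import Data.List.Relation.Unary.All as All using ([]; _∷_)
import Data.List.Relation.Unary.All.Properties as All
open import Data.List.Relation.Unary.AllPairs as AllPairs using (AllPairs; _∷_)
import Data.List.Relation.Unary.AllPairs.Properties as AllPairs
open import Data.List.Relation.Unary.Any using (here; there)
open import Data.List.Relation.Unary.Unique.Propositional using (Unique)
open import Data.List.Relation.Unary.Unique.Propositional.Properties
  using (++⁺; allFin⁺; cartesianProduct⁺; filter⁺; map⁺; upTo⁺)
open import Data.Nat.Base as ℕ using (ℕ; zero; suc; _∸_; _≤_; _<_; _>_; z≤n; s≤s)
import Data.Nat.Properties as ℕ
open import Data.Product.Base using (_×_; _,_; ∃; ∃₂; proj₁; proj₂; uncurry)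
open import Data.Sum.Base using (_⊎_; inj₁; inj₂; [_,_]; [_,_]′)
open import Data.Vec.Base as Vec using (Vec; []; _∷_; insertAt; lookup; tabulate)
open import Data.Vec.Properties
  using (insertAt-lookup; insertAt-punchIn; lookup-map; lookup∘tabulate; tabulate-cong; tabulate∘lookup)
open import Function.Base using (_∘_; id)
open import Function.Bundles using (_⇔_; mk⇔; Equivalence)
open import Relation.Binary using (tri<; tri≈; tri>)
open import Relation.Binary.PropositionalEquality
  using (_≡_; _≢_; refl; sym; trans; cong; cong₂; subst; subst₂; _≗_)
open import Relation.Nullary using (¬_; Dec; yes; no; contradiction)
open import Relation.Nullary.Decidable using (from-yes)

-- A maximum inserted into the gap `z` closes a free gap at or left of `z` exactly if an ascent ends
-- before that gap, because the maximum completes a 123. It closes a free gap at or right of `z`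
-- exactly if some ascent starts right of `z` and ends right of that gap, because the maximum is the
-- 3 of a 312. The two halves of `z` itself obey one criterion each. So the label need only record
-- which gaps have such ascents: none ends before α, and one ends before each free gap above α. A
-- star has an ascent entirely right of α; only without one do both halves of α stay free after an
-- insertion at α. Raising e by one moves the child at α from e to e + 1 and adds one more child
-- with e + 1, so Sₑ₊₁ - Sₑ = x (2 Sₑ₊₁ - Sₑ). The two kinds differ only in the child at α, so Pₑ =
-- (1-x) Sₑ + x Pₑ₊₁. If Pₑ₊₁ relates to Pₑ as Sₑ₊₁ to Sₑ, this forces the factor 1-3x+x².

private
  variable
    m n : ℕ

-- Inserting a new maximum

data Forbidden (f : Fin m → ℕ) : Set where
  p1243 : ∀ {i j k l} → i Fin.< j → j Fin.< k → k Fin.< l →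
          f i < f j → f j < f l → f l < f k → Forbidden f
  p3142 : ∀ {i j k l} → i Fin.< j → j Fin.< k → k Fin.< l →
          f j < f l → f l < f i → f i < f k → Forbidden f
  p3412 : ∀ {i j k l} → i Fin.< j → j Fin.< k → k Fin.< l →
          f k < f l → f l < f i → f i < f j → Forbidden f

-- A gap x of a word of length m, 0 ≤ x ≤ m, has the positions i < x on its left. A new maximum
-- completes 1243 from a 12|3, 3142 from a 31|2 and 3412 from a 3|12, where | is the gap.
data Blocked (f : Fin m → ℕ) (x : ℕ) : Set where
  p312 : ∀ {i j k} → i Fin.< j → j Fin.< k → f j < f k → f k < f i →
         toℕ i < x → x ≤ toℕ k → Blocked f x
  p123 : ∀ {i j k} → i Fin.< j → j Fin.< k → f i < f j → f j < f k →
         toℕ j < x → x ≤ toℕ k → Blocked f x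

-- Not only at adjacent positions: i < j and f i < f j.
record Ascent (f : Fin m → ℕ) (y x : ℕ) : Set where
  constructor ascent
  field
    {i j} : Fin m
    i<j   : i Fin.< j
    fi<fj : f i < f j
    y≤i   : y ≤ toℕ i
    x≤j   : x ≤ toℕ j

record AscentBefore (f : Fin m → ℕ) (y : ℕ) : Set where
  constructor ascent
  field
    {i j} : Fin m
    i<j   : i Fin.< j
    fi<fj : f i < f j
    j<y   : toℕ j < y

ascent-antitone : ∀ {f : Fin m → ℕ} {y y′ x x′} → y′ ≤ y → x′ ≤ x → Ascent f y x → Ascent f y′ x′
ascent-antitone y′≤y x′≤x (ascent i<j lt y≤i x≤j) =
  ascent i<j lt (ℕ.≤-trans y′≤y y≤i) (ℕ.≤-trans x′≤x x≤j)

ascentBefore-monotone : ∀ {f : Fin m → ℕ} {y y′} → y ≤ y′ → AscentBefore f y → AscentBefore f y′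
ascentBefore-monotone y≤y′ (ascent i<j lt j<y) = ascent i<j lt (ℕ.<-≤-trans j<y y≤y′)

-- The gap z splits into z and 1 + z, the gaps before and after the new letter.
data Lift (z : ℕ) : ℕ → ℕ → Set where
  low  : ∀ {y} → y ≤ z → Lift z y y
  high : ∀ {y} → z ≤ y → Lift z y (suc y)

module _ {z : Fin (suc m)} where

  punchIn-< : ∀ {y ŷ} → Lift (toℕ z) y ŷ → (i : Fin m) → toℕ i < y → toℕ (punchIn z i) < ŷ
  punchIn-< = go z
    where
    go : ∀ {m} (z : Fin (suc m)) {y ŷ} → Lift (toℕ z) y ŷ → (i : Fin m) →
      toℕ i < y → toℕ (punchIn z i) < ŷ
    go zero    (low z≤n)        i       ()
    go zero    (high _)         i       i<y       = s≤s i<y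
    go (suc z) (low _)          zero    i<y       = i<y
    go (suc z) (high _)         zero    i<y       = ℕ.m<n⇒m<1+n i<y
    go (suc z) (low (s≤s y≤z))  (suc i) (s≤s i<y) = s≤s (go z (low y≤z) i i<y)
    go (suc z) (high (s≤s z≤y)) (suc i) (s≤s i<y) = s≤s (go z (high z≤y) i i<y)

  punchIn-≥ : ∀ {y ŷ} → Lift (toℕ z) y ŷ → (i : Fin m) → y ≤ toℕ i → ŷ ≤ toℕ (punchIn z i)
  punchIn-≥ = go z
    where
    go : ∀ {m} (z : Fin (suc m)) {y ŷ} → Lift (toℕ z) y ŷ → (i : Fin m) →
      y ≤ toℕ i → ŷ ≤ toℕ (punchIn z i)
    go zero    (low z≤n)        i       _         = z≤n
    go zero    (high _)         i       y≤i       = s≤s y≤i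
    go (suc z) (low _)          zero    z≤n       = z≤n
    go (suc z) (high ())        zero    z≤n
    go (suc z) (low _)          (suc i) z≤n       = z≤n
    go (suc z) (low (s≤s y≤z))  (suc i) (s≤s y≤i) = s≤s (go z (low y≤z) i y≤i)
    go (suc z) (high (s≤s z≤y)) (suc i) (s≤s y≤i) = s≤s (go z (high z≤y) i y≤i)

  punchIn-<⁻ : ∀ {y ŷ} → Lift (toℕ z) y ŷ → (i : Fin m) → toℕ (punchIn z i) < ŷ → toℕ i < y
  punchIn-<⁻ y↑ i lt = ℕ.≰⇒> λ y≤i → ℕ.<⇒≱ lt (punchIn-≥ y↑ i y≤i)

  punchIn-≥⁻ : ∀ {y ŷ} → Lift (toℕ z) y ŷ → (i : Fin m) → ŷ ≤ toℕ (punchIn z i) → y ≤ toℕ i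
  punchIn-≥⁻ y↑ i le = ℕ.≮⇒≥ λ i<y → ℕ.≤⇒≯ le (punchIn-< y↑ i i<y)

  punchIn-mono-< : ∀ {i j : Fin m} → i Fin.< j → punchIn z i Fin.< punchIn z j
  punchIn-mono-< {i} {j} i<j = ℕ.≤∧≢⇒< (Fin.punchIn-mono-≤ z i j (ℕ.<⇒≤ i<j))
    λ eq → ℕ.<⇒≢ i<j (cong toℕ (Fin.punchIn-injective z i j (Fin.toℕ-injective eq)))

  punchIn-cancel-< : ∀ {i j : Fin m} → punchIn z i Fin.< punchIn z j → i Fin.< j
  punchIn-cancel-< {i} {j} lt = ℕ.≰⇒> λ j≤i → ℕ.<⇒≱ lt (Fin.punchIn-mono-≤ z j i j≤i)

data Split (z : Fin (suc m)) : Fin (suc m) → Set where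
  new : Split z z
  old : ∀ i → Split z (punchIn z i)

splitView : ∀ (z k : Fin (suc m)) → Split z k
splitView z k with z Fin.≟ k
... | yes refl = new
... | no  z≢k  = subst (Split z) (Fin.punchIn-punchOut z≢k) (old _)

module Insertion (f : Fin m → ℕ) (g : Fin (suc m) → ℕ) (z : Fin (suc m))
  (g-old : ∀ i → g (punchIn z i) ≡ f i) (g-new : ∀ i → f i < g z) where

  private
    e : Fin m → Fin (suc m)
    e = punchIn z

    up : ∀ {i j} → f i < f j → g (e i) < g (e j)
    up = subst₂ _<_ (sym (g-old _)) (sym (g-old _))

    down : ∀ {i j} → g (e i) < g (e j) → f i < f j
    down = subst₂ _<_ (g-old _) (g-old _)

    max : ∀ {i} → g (e i) < g z
    max {i} = subst (_< g z) (sym (g-old i)) (g-new i)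

    -- A letter smaller than another one is not the maximum. The chained inequalities of a pattern
    -- thus make all its letters old except the largest, whose position is the only one to be split
    -- on.
    below-max : ∀ {i j} → g i < g j → ∃ λ i′ → e i′ ≡ i
    below-max {i} {j} lt with splitView z i | splitView z j
    ... | old i′ | _      = i′ , refl
    ... | new    | new    = contradiction lt (ℕ.<-irrefl refl)
    ... | new    | old j′ = contradiction lt (ℕ.<-asym max)

    left : ∀ {i} → toℕ i < toℕ z → e i Fin.< z
    left = punchIn-< (low ℕ.≤-refl) _

    left⁻ : ∀ {i} → e i Fin.< z → toℕ i < toℕ z
    left⁻ = punchIn-<⁻ (low ℕ.≤-refl) _

    right : ∀ {i} → toℕ z ≤ toℕ i → z Fin.< e i
    right = punchIn-≥ (high ℕ.≤-refl) _

    right⁻ : ∀ {i} → z Fin.< e i → toℕ z ≤ toℕ i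
    right⁻ = punchIn-≥⁻ (high ℕ.≤-refl) _

    mono : ∀ {i j} → i Fin.< j → e i Fin.< e j
    mono = punchIn-mono-<

    cancel : ∀ {i j} → e i Fin.< e j → i Fin.< j
    cancel = punchIn-cancel-<

  forbidden-old : Forbidden f → Forbidden g
  forbidden-old (p1243 a b c x y w) = p1243 (mono a) (mono b) (mono c) (up x) (up y) (up w)
  forbidden-old (p3142 a b c x y w) = p3142 (mono a) (mono b) (mono c) (up x) (up y) (up w)
  forbidden-old (p3412 a b c x y w) = p3412 (mono a) (mono b) (mono c) (up x) (up y) (up w)

  -- The gap of a 312 may lie on either side of the 1, and this side decides between 3142 and 3412;
  -- hence `p312` leaves it open.
  blocked⇒forbidden : Blocked f (toℕ z) → Forbidden g
  blocked⇒forbidden (p123 i<j j<k x y j<z z≤k) =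
    p1243 (mono i<j) (left j<z) (right z≤k) (up x) (up y) max
  blocked⇒forbidden (p312 {i} {j} {k} i<j j<k x y i<z z≤k) with toℕ j ℕ.<? toℕ z
  ... | yes j<z = p3142 (mono i<j) (left j<z) (right z≤k) (up x) (up y) max
  ... | no  j≮z = p3412 (left i<z) (right (ℕ.≮⇒≥ j≮z)) (mono j<k) (up x) (up y) max

  forbidden⁻ : Forbidden g → Forbidden f ⊎ Blocked f (toℕ z)
  forbidden⁻ (p1243 {k = k} a b c x y w) with below-max x | below-max y | below-max w | splitView z k
  ... | _ , refl | _ , refl | _ , refl | new   =
    inj₂ (p123 (cancel a) (ℕ.<-≤-trans (left⁻ b) (right⁻ c)) (down x) (down y) (left⁻ b) (right⁻ c))
  ... | _ , refl | _ , refl | _ , refl | old _ =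
    inj₁ (p1243 (cancel a) (cancel b) (cancel c) (down x) (down y) (down w))
  forbidden⁻ (p3142 {k = k} a b c x y w) with below-max x | below-max y | below-max w | splitView z k
  ... | _ , refl | _ , refl | _ , refl | new   =
    inj₂ (p312 (cancel a) (ℕ.<-≤-trans (left⁻ b) (right⁻ c)) (down x) (down y)
      (ℕ.<-trans (cancel a) (left⁻ b)) (right⁻ c))
  ... | _ , refl | _ , refl | _ , refl | old _ =
    inj₁ (p3142 (cancel a) (cancel b) (cancel c) (down x) (down y) (down w))
  forbidden⁻ (p3412 {j = j} a b c x y w) with below-max x | below-max y | below-max w | splitView z j
  ... | _ , refl | _ , refl | _ , refl | new   =
    inj₂ (p312 (ℕ.<-≤-trans (left⁻ a) (right⁻ b)) (cancel c) (down x) (down y)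
      (left⁻ a) (ℕ.≤-trans (right⁻ b) (ℕ.<⇒≤ (cancel c))))
  ... | _ , refl | _ , refl | _ , refl | old _ =
    inj₁ (p3412 (cancel a) (cancel b) (cancel c) (down x) (down y) (down w))

  blocked-old : ∀ {y ŷ} → Lift (toℕ z) y ŷ → Blocked f y → Blocked g ŷ
  blocked-old y↑ (p312 a b x w l r) =
    p312 (mono a) (mono b) (up x) (up w) (punchIn-< y↑ _ l) (punchIn-≥ y↑ _ r)
  blocked-old y↑ (p123 a b x w l r) =
    p123 (mono a) (mono b) (up x) (up w) (punchIn-< y↑ _ l) (punchIn-≥ y↑ _ r)

  blocked-low : ∀ {y} → y ≤ toℕ z → AscentBefore f y → Blocked g y
  blocked-low y≤z (ascent i<j lt j<y) =
    p123 (mono i<j) (left (ℕ.<-≤-trans j<y y≤z)) (up lt) max (punchIn-< (low y≤z) _ j<y) y≤z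

  blocked-high : ∀ {y} → toℕ z ≤ y → Ascent f (toℕ z) y → Blocked g (suc y)
  blocked-high z≤y (ascent i<j lt z≤i y≤j) =
    p312 (right z≤i) (mono i<j) (up lt) max (s≤s z≤y) (punchIn-≥ (high z≤y) _ y≤j)

  blocked-low⁻ : ∀ {y} → y ≤ toℕ z → Blocked g y → Blocked f y ⊎ AscentBefore f y
  blocked-low⁻ y≤z (p312 {i = i} a b x w l r) with below-max x | below-max w | splitView z i
  ... | _ , refl | _ , refl | new   = contradiction l (ℕ.≤⇒≯ y≤z)
  ... | _ , refl | _ , refl | old _ =
    inj₁ (p312 (cancel a) (cancel b) (down x) (down w)
      (punchIn-<⁻ (low y≤z) _ l) (punchIn-≥⁻ (low y≤z) _ r))
  blocked-low⁻ y≤z (p123 {k = k} a b x w l r) with below-max x | below-max w | splitView z k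
  ... | _ , refl | _ , refl | new   = inj₂ (ascent (cancel a) (down x) (punchIn-<⁻ (low y≤z) _ l))
  ... | _ , refl | _ , refl | old _ =
    inj₁ (p123 (cancel a) (cancel b) (down x) (down w)
      (punchIn-<⁻ (low y≤z) _ l) (punchIn-≥⁻ (low y≤z) _ r))

  blocked-high⁻ : ∀ {y} → toℕ z ≤ y → Blocked g (suc y) → Blocked f y ⊎ Ascent f (toℕ z) y
  blocked-high⁻ z≤y (p312 {i = i} a b x w l r) with below-max x | below-max w | splitView z i
  ... | _ , refl | _ , refl | new   =
    inj₂ (ascent (cancel b) (down x) (right⁻ a) (punchIn-≥⁻ (high z≤y) _ r))
  ... | _ , refl | _ , refl | old _ =
    inj₁ (p312 (cancel a) (cancel b) (down x) (down w)
      (punchIn-<⁻ (high z≤y) _ l) (punchIn-≥⁻ (high z≤y) _ r))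
  blocked-high⁻ z≤y (p123 {k = k} a b x w l r) with below-max x | below-max w | splitView z k
  ... | _ , refl | _ , refl | new   = contradiction (ℕ.≤-trans r z≤y) (ℕ.<-irrefl refl)
  ... | _ , refl | _ , refl | old _ =
    inj₁ (p123 (cancel a) (cancel b) (down x) (down w)
      (punchIn-<⁻ (high z≤y) _ l) (punchIn-≥⁻ (high z≤y) _ r))

  ascent-old : ∀ {y ŷ x x̂} → Lift (toℕ z) y ŷ → Lift (toℕ z) x x̂ → Ascent f y x → Ascent g ŷ x̂
  ascent-old y↑ x↑ (ascent i<j lt y≤i x≤j) =
    ascent (mono i<j) (up lt) (punchIn-≥ y↑ _ y≤i) (punchIn-≥ x↑ _ x≤j)

  -- The letter directly right of the gap `y` has position `y`, which exists as `y < z ≤ m`; the new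
  -- maximum completes the ascent.
  ascent-new : ∀ {y x} → y < toℕ z → x ≤ toℕ z → Ascent g y x
  ascent-new y<z x≤z = ascent (left i<z) max (punchIn-≥ (low (ℕ.<⇒≤ y<z)) _ (ℕ.≤-reflexive (sym i≡y))) x≤z
    where
    y<m = ℕ.<-≤-trans y<z (Fin.toℕ≤pred[n] z)
    i≡y = Fin.toℕ-fromℕ< y<m
    i<z = subst (_< toℕ z) (sym i≡y) y<z

  ascent⁻ : ∀ {y ŷ x x̂} → Lift (toℕ z) y ŷ → Lift (toℕ z) x x̂ → Ascent g ŷ x̂ →
            Ascent f y x ⊎ (ŷ < toℕ z × x̂ ≤ toℕ z)
  ascent⁻ y↑ x↑ (ascent {j = j} i<j lt y≤i x≤j) with below-max lt | splitView z j
  ... | _ , refl | new   = inj₂ (ℕ.≤-<-trans y≤i i<j , x≤j)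
  ... | _ , refl | old _ =
    inj₁ (ascent (cancel i<j) (down lt) (punchIn-≥⁻ y↑ _ y≤i) (punchIn-≥⁻ x↑ _ x≤j))

  before-old : ∀ {y ŷ} → Lift (toℕ z) y ŷ → AscentBefore f y → AscentBefore g ŷ
  before-old y↑ (ascent i<j lt j<y) = ascent (mono i<j) (up lt) (punchIn-< y↑ _ j<y)

  before-new : ∀ {y} → 0 < toℕ z → toℕ z < y → AscentBefore g y
  before-new 0<z z<y = ascent (left (subst (_< toℕ z) (sym (Fin.toℕ-fromℕ< 0<m)) 0<z)) max z<y
    where 0<m = ℕ.<-≤-trans 0<z (Fin.toℕ≤pred[n] z)

  before⁻ : ∀ {y ŷ} → Lift (toℕ z) y ŷ → AscentBefore g ŷ → AscentBefore f y ⊎ toℕ z < ŷ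
  before⁻ y↑ (ascent {j = j} i<j lt j<y) with below-max lt | splitView z j
  ... | _ , refl | new   = inj₂ j<y
  ... | _ , refl | old _ = inj₁ (ascent (cancel i<j) (down lt) (punchIn-<⁻ y↑ _ j<y))

-- Labels

module _ {A : Set} {R : A → A → Set} where

  AllPairs-++⁻ʳ : ∀ xs {ys} → AllPairs R (xs ++ ys) → AllPairs R ys
  AllPairs-++⁻ʳ []       rs       = rs
  AllPairs-++⁻ʳ (x ∷ xs) (_ ∷ rs) = AllPairs-++⁻ʳ xs rs

  AllPairs-++⁻ : ∀ xs {ys x y} → AllPairs R (xs ++ ys) → x ∈ xs → y ∈ ys → R x y
  AllPairs-++⁻ (x ∷ xs) (r ∷ _)  (here refl) y∈ = All.lookup r (∈-++⁺ʳ xs y∈)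
  AllPairs-++⁻ (x ∷ xs) (_ ∷ rs) (there x∈)  y∈ = AllPairs-++⁻ xs rs x∈ y∈

  AllPairs-∷⁻ : ∀ {x y xs} → AllPairs R (x ∷ xs) → y ∈ xs → R x y
  AllPairs-∷⁻ (r ∷ _) = All.lookup r

Free : (Fin m → ℕ) → ℕ → Set
Free {m} f y = y ≤ m × ¬ Blocked f y

-- A lists the free gaps below α, nearest first, and E ++ C those above α. A maximum inserted into
-- a gap of A closes the gaps of E and leaves those of C free.
record Labelled (f : Fin m → ℕ) (α : ℕ) (A E C : List ℕ) : Set where
  field
    complete     : ∀ {y} → Free f y → y ∈ α ∷ A ⊎ y ∈ E ++ C
    lower-free   : ∀ {y} → y ∈ α ∷ A → Free f y
    upper-free   : ∀ {y} → y ∈ E ++ C → Free f y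
    lower-sorted : AllPairs _>_ (α ∷ A)
    upper-sorted : AllPairs _<_ (α ∷ E ++ C)
    α-not-before : ¬ AscentBefore f α
    upper-before : ∀ {y} → y ∈ E ++ C → AscentBefore f y
    ascents      : ∀ {y x} → y ∈ A → x ∈ α ∷ E → Ascent f y x
    no-ascent-C  : ∀ {x} → x ∈ C → ¬ Ascent f 0 x
    no-ascent-α  : ∀ {x} → x ∈ E ++ C → ¬ Ascent f α x

record Star (f : Fin m → ℕ) (α : ℕ) (A E C : List ℕ) : Set where
  field
    labelled : Labelled f α A E C
    ascent-α : Ascent f α α
  open Labelled labelled public

-- `α-positive` puts a letter before α. With a maximum inserted at α it forms the ascent that has to
-- precede the right half of α, an upper gap of the child.
record Plain (f : Fin m → ℕ) (α : ℕ) (A E C : List ℕ) : Set where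
  field
    labelled     : Labelled f α A E C
    no-ascent-αα : ¬ Ascent f α α
    α-positive   : 0 < α
  open Labelled labelled public

module Children (f : Fin m → ℕ) (g : Fin (suc m) → ℕ) (z : Fin (suc m))
  (g-old : ∀ i → g (punchIn z i) ≡ f i) (g-new : ∀ i → f i < g z) where

  open Insertion f g z g-old g-new

  -- `E` and `C` hold the old gaps whose right halves stay free, hence `map suc` in the result. The
  -- alternative `0 < toℕ z` replaces an old ascent by the one from the first letter to the maximum,
  -- which ends before every right half.
  child : ∀ {α A E C} →
    (∀ {y} → y ∈ α ∷ A → y ≤ toℕ z × Free f y × ¬ AscentBefore f y) →
    (∀ {y} → y ∈ E ++ C → toℕ z ≤ y × Free f y × (AscentBefore f y ⊎ 0 < toℕ z)) →
    (∀ {y} → y ≤ toℕ z → Free f y → ¬ AscentBefore f y → y ∈ α ∷ A) →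
    (∀ {y} → toℕ z ≤ y → Free f y → ¬ Ascent f (toℕ z) y → y ∈ E ++ C) →
    AllPairs _>_ (α ∷ A) → AllPairs _<_ (E ++ C) →
    (∀ {y x} → y ∈ A → x ∈ E → Ascent f y x) →
    (∀ {x} → x ∈ C → ¬ Ascent f 0 x) →
    (∀ {x} → x ∈ E ++ C → ¬ Ascent f α x) →
    Labelled g α A (map suc E) (map suc C)
  child {α} {A} {E} {C} lower upper lower⁻ upper⁻ sorted> sorted< asc ¬asc-C ¬asc-α = record
    { complete     = complete
    ; lower-free   = lower-free
    ; upper-free   = λ y∈ → upper-free (lifted y∈)
    ; lower-sorted = sorted>
    ; upper-sorted = subst (AllPairs _<_ ∘ (α ∷_)) (map-++ suc E C)
        (All.map⁺ (All.tabulate λ y∈ → s≤s (ℕ.≤-trans α≤z (proj₁ (upper y∈))))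
         ∷ AllPairs.map⁺ (AllPairs.map s≤s sorted<))
    ; α-not-before = [ proj₂ (proj₂ (lower (here refl))) , ℕ.≤⇒≯ α≤z ] ∘ before⁻ (low α≤z)
    ; upper-before = λ y∈ → upper-before (lifted y∈)
    ; ascents      = ascents
    ; no-ascent-C  = λ x∈ → no-ascent-C (∈-map⁻ suc x∈)
    ; no-ascent-α  = λ x∈ → no-ascent-α (lifted x∈)
    }
    where
    α≤z : α ≤ toℕ z
    α≤z = proj₁ (lower (here refl))

    lifted : ∀ {ŷ} → ŷ ∈ map suc E ++ map suc C → ∃ λ y → y ∈ E ++ C × ŷ ≡ suc y
    lifted y∈ = ∈-map⁻ suc (subst (_ ∈_) (sym (map-++ suc E C)) y∈)

    complete : ∀ {y} → Free g y → y ∈ α ∷ A ⊎ y ∈ map suc E ++ map suc C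
    complete {y} (y≤ , ¬b) with y ℕ.≤? toℕ z
    ... | yes y≤z = inj₁ (lower⁻ y≤z
            (ℕ.≤-trans y≤z (Fin.toℕ≤pred[n] z) , ¬b ∘ blocked-old (low y≤z)) (¬b ∘ blocked-low y≤z))
    complete {zero}  _ | no y≰z = contradiction z≤n y≰z
    complete {suc y} (s≤s y≤ , ¬b) | no y≰z = inj₂ (subst (_ ∈_) (map-++ suc E C)
        (∈-map⁺ suc (upper⁻ z≤y (y≤ , ¬b ∘ blocked-old (high z≤y)) (¬b ∘ blocked-high z≤y))))
      where z≤y = ℕ.≤-pred (ℕ.≰⇒> y≰z)

    lower-free : ∀ {y} → y ∈ α ∷ A → Free g y
    lower-free y∈ with lower y∈
    ... | y≤z , (y≤m , ¬b) , ¬before = ℕ.m≤n⇒m≤1+n y≤m , [ ¬b , ¬before ] ∘ blocked-low⁻ y≤z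

    upper-free : ∀ {ŷ} → (∃ λ y → y ∈ E ++ C × ŷ ≡ suc y) → Free g ŷ
    upper-free (y , y∈ , refl) with upper y∈
    ... | z≤y , (y≤m , ¬b) , _ =
      s≤s y≤m , [ ¬b , ¬asc-α y∈ ∘ ascent-antitone α≤z ℕ.≤-refl ] ∘ blocked-high⁻ z≤y

    upper-before : ∀ {ŷ} → (∃ λ y → y ∈ E ++ C × ŷ ≡ suc y) → AscentBefore g ŷ
    upper-before (y , y∈ , refl) with upper y∈
    ... | z≤y , _ , inj₁ before = before-old (high z≤y) before
    ... | z≤y , _ , inj₂ 0<z    = before-new 0<z (s≤s z≤y)

    ascents : ∀ {y x} → y ∈ A → x ∈ α ∷ map suc E → Ascent g y x
    ascents y∈ (here refl) = ascent-new (ℕ.<-≤-trans (AllPairs-∷⁻ sorted> y∈) α≤z) α≤z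
    ascents y∈ (there x∈) with ∈-map⁻ suc x∈
    ... | x , x∈E , refl =
      ascent-old (low (proj₁ (lower (there y∈)))) (high (proj₁ (upper (∈-++⁺ˡ x∈E)))) (asc y∈ x∈E)

    no-ascent-C : ∀ {x̂} → (∃ λ x → x ∈ C × x̂ ≡ suc x) → ¬ Ascent g 0 x̂
    no-ascent-C (x , x∈ , refl) = [ ¬asc-C x∈ , ℕ.≤⇒≯ z≤x ∘ proj₂ ] ∘ ascent⁻ (low z≤n) (high z≤x)
      where z≤x = proj₁ (upper (∈-++⁺ʳ E x∈))

    no-ascent-α : ∀ {x̂} → (∃ λ x → x ∈ E ++ C × x̂ ≡ suc x) → ¬ Ascent g α x̂
    no-ascent-α (x , x∈ , refl) = [ ¬asc-α x∈ , ℕ.≤⇒≯ z≤x ∘ proj₂ ] ∘ ascent⁻ (low α≤z) (high z≤x)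
      where z≤x = proj₁ (upper x∈)

  -- An ascent starts right of `z` and reaches beyond α and each gap of `E`, so everything above `z`
  -- closes except `C`, beyond which no ascent ends. The same ascent makes the child a star.
  lower-child : ∀ {α A₁ A₂ E C} → Labelled f α (A₁ ++ toℕ z ∷ A₂) E C →
    Star g (toℕ z) A₂ [] (map suc C)
  lower-child {α} {A₁} {A₂} {E} {C} L = record
    { labelled = child
        (λ y∈ → y≤z y∈ , lower-free (suffix y∈)
              , α-not-before ∘ ascentBefore-monotone (ℕ.≤-trans (y≤z y∈) (ℕ.<⇒≤ z<α)))
        (λ y∈ → ℕ.<⇒≤ (z<U (∈-++⁺ʳ E y∈)) , upper-free (∈-++⁺ʳ E y∈)
              , inj₁ (upper-before (∈-++⁺ʳ E y∈)))
        (λ y≤z free ¬before →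
          [ below-z y≤z , (λ y∈ → contradiction (upper-before y∈) ¬before) ] (complete free))
        (λ _ free ¬asc → [ (λ y∈ → contradiction (ascent-from-z y∈) ¬asc) , above-z ¬asc ] (complete free))
        sorted
        (AllPairs-++⁻ʳ E (AllPairs.tail upper-sorted))
        (λ _ ())
        no-ascent-C
        (λ x∈ → no-ascent-C x∈ ∘ ascent-antitone z≤n ℕ.≤-refl)
    ; ascent-α = ascent-old (low ℕ.≤-refl) (low ℕ.≤-refl)
        (ascent-antitone ℕ.≤-refl (ℕ.<⇒≤ z<α) (ascents z∈ (here refl)))
    }
    where
    open Labelled L
    z∈ : toℕ z ∈ A₁ ++ toℕ z ∷ A₂
    z∈ = ∈-++⁺ʳ A₁ (here refl)
    z<α : toℕ z < α
    z<α = AllPairs-∷⁻ lower-sorted z∈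
    z<U : ∀ {y} → y ∈ E ++ C → toℕ z < y
    z<U y∈ = ℕ.<-trans z<α (AllPairs-∷⁻ upper-sorted y∈)
    ascent-from-z : ∀ {y} → y ∈ α ∷ A₁ ++ toℕ z ∷ A₂ → Ascent f (toℕ z) y
    ascent-from-z (here refl) = ascents z∈ (here refl)
    ascent-from-z (there y∈)  =
      ascent-antitone ℕ.≤-refl (ℕ.<⇒≤ (AllPairs-∷⁻ lower-sorted y∈)) (ascents z∈ (here refl))
    above-z : ∀ {y} → ¬ Ascent f (toℕ z) y → y ∈ E ++ C → y ∈ C
    above-z ¬asc y∈ with ∈-++⁻ E y∈
    ... | inj₁ y∈E = contradiction (ascents z∈ (there y∈E)) ¬asc
    ... | inj₂ y∈C = y∈C
    suffix : ∀ {y} → y ∈ toℕ z ∷ A₂ → y ∈ α ∷ A₁ ++ toℕ z ∷ A₂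
    suffix y∈ = there (∈-++⁺ʳ A₁ y∈)
    sorted : AllPairs _>_ (toℕ z ∷ A₂)
    sorted = AllPairs-++⁻ʳ (α ∷ A₁) lower-sorted
    y≤z : ∀ {y} → y ∈ toℕ z ∷ A₂ → y ≤ toℕ z
    y≤z (here refl) = ℕ.≤-refl
    y≤z (there y∈)  = ℕ.<⇒≤ (AllPairs-∷⁻ sorted y∈)
    below-z : ∀ {y} → y ≤ toℕ z → y ∈ α ∷ A₁ ++ toℕ z ∷ A₂ → y ∈ toℕ z ∷ A₂
    below-z y≤z y∈ with ∈-++⁻ (α ∷ A₁) y∈
    ... | inj₁ y∈₁ =
      contradiction y≤z (ℕ.<⇒≱ (AllPairs-++⁻ (α ∷ A₁) lower-sorted y∈₁ (here refl)))
    ... | inj₂ y∈₂ = y∈₂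

  -- Insertion at α or above leaves the gaps up to α alone, because no ascent ends before them. `U`
  -- is the prefix that closes; the list starts with α so that the right half of α may be among the
  -- survivors.
  upper-child : ∀ {α A E C} E′ C′ U → Labelled f α A E C → α ∷ E ++ C ≡ U ++ E′ ++ C′ → α ≤ toℕ z →
    (∀ {y} → y ∈ E′ ++ C′ → toℕ z ≤ y × (AscentBefore f y ⊎ 0 < toℕ z) × ¬ Ascent f α y) →
    (∀ {y} → y ∈ U → toℕ z ≤ y → Ascent f (toℕ z) y) →
    (∀ {x} → x ∈ E′ → x ∈ α ∷ E) → (∀ {x} → x ∈ C′ → x ∈ C) →
    Labelled g α A (map suc E′) (map suc C′)
  upper-child {α} {A} {E} {C} E′ C′ U L eq α≤z upper prefix E′⊆ C′⊆ = child
    (λ y∈ → ℕ.≤-trans (y≤α y∈) α≤z , lower-free y∈ , α-not-before ∘ ascentBefore-monotone (y≤α y∈))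
    (λ y∈ → proj₁ (upper y∈) , free y∈ , proj₁ (proj₂ (upper y∈)))
    (λ _ fr ¬before → [ (λ y∈ → y∈) , (λ y∈ → contradiction (upper-before y∈) ¬before) ] (complete fr))
    (λ z≤y fr ¬asc → above
      ([ (λ y∈ → here (ℕ.≤-antisym (y≤α y∈) (ℕ.≤-trans α≤z z≤y))) , there ]′ (complete fr)) z≤y ¬asc)
    lower-sorted
    (AllPairs-++⁻ʳ U (subst (AllPairs _<_) eq upper-sorted))
    (λ y∈ x∈ → ascents y∈ (E′⊆ x∈))
    (no-ascent-C ∘ C′⊆)
    (proj₂ ∘ proj₂ ∘ upper)
    where
    open Labelled L
    y≤α : ∀ {y} → y ∈ α ∷ A → y ≤ α
    y≤α (here refl) = ℕ.≤-refl
    y≤α (there y∈)  = ℕ.<⇒≤ (AllPairs-∷⁻ lower-sorted y∈)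
    free : ∀ {y} → y ∈ E′ ++ C′ → Free f y
    free y∈ with subst (_ ∈_) (sym eq) (∈-++⁺ʳ U y∈)
    ... | here refl = lower-free (here refl)
    ... | there y∈U = upper-free y∈U
    above : ∀ {y} → y ∈ α ∷ E ++ C → toℕ z ≤ y → ¬ Ascent f (toℕ z) y → y ∈ E′ ++ C′
    above y∈ z≤y ¬asc with ∈-++⁻ U (subst (_ ∈_) eq y∈)
    ... | inj₁ y∈U = contradiction (prefix y∈U z≤y) ¬asc
    ... | inj₂ y∈′ = y∈′

  star-at-α : ∀ {A E C} → Star f (toℕ z) A E C → Star g (toℕ z) A (map suc E) (map suc C)
  star-at-α {A} {E} {C} S = record
    { labelled = upper-child E C (toℕ z ∷ []) labelled refl ℕ.≤-refl
        (λ y∈ → ℕ.<⇒≤ (AllPairs-∷⁻ upper-sorted y∈) , inj₁ (upper-before y∈) , no-ascent-α y∈)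
        (λ { (here refl) _ → ascent-α })
        there (λ x∈ → x∈)
    ; ascent-α = ascent-old (low ℕ.≤-refl) (low ℕ.≤-refl) ascent-α
    }
    where open Star S

  -- The right half of α survives and joins `E`. The ascents this demands from the gaps of `A` are
  -- those of α itself, which is why `ascents` ranges over `α ∷ E`.
  plain-at-α : ∀ {A E C} → Plain f (toℕ z) A E C →
    Plain g (toℕ z) A (map suc (toℕ z ∷ E)) (map suc C)
  plain-at-α {A} {E} {C} S = record
    { labelled = upper-child (toℕ z ∷ E) C [] labelled refl ℕ.≤-refl
        (λ { (here refl) → ℕ.≤-refl , inj₂ α-positive , no-ascent-αα
           ; (there y∈)  →
               ℕ.<⇒≤ (AllPairs-∷⁻ upper-sorted y∈) , inj₁ (upper-before y∈) , no-ascent-α y∈ })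
        (λ ())
        (λ x∈ → x∈) (λ x∈ → x∈)
    ; no-ascent-αα = [ no-ascent-αα , ℕ.<-irrefl refl ∘ proj₁ ] ∘ ascent⁻ (low ℕ.≤-refl) (low ℕ.≤-refl)
    ; α-positive = α-positive
    }
    where open Plain S

  -- The letter right of α and the maximum form an ascent right of α, so the child is a star
  -- whatever the kind of its parent.
  beyond-α : ∀ {α A E C} E′ C′ U → Labelled f α A E C → E ++ C ≡ U ++ E′ ++ C′ →
    (∃ λ V → E′ ++ C′ ≡ toℕ z ∷ V) → (∀ {x} → x ∈ E′ → x ∈ E) → (∀ {x} → x ∈ C′ → x ∈ C) →
    Star g α A (map suc E′) (map suc C′)
  beyond-α {α} {A} {E} {C} E′ C′ U L eq (V , eq′) E′⊆ C′⊆ = record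
    { labelled = upper-child E′ C′ (α ∷ U) L (cong (α ∷_) eq) (ℕ.<⇒≤ α<z)
        (λ y∈ → z≤ y∈ , inj₂ (ℕ.≤-<-trans z≤n α<z) , no-ascent-α (subst (_ ∈_) (sym eq) (∈-++⁺ʳ U y∈)))
        (λ y∈ z≤y → contradiction z≤y (ℕ.<⇒≱ (AllPairs-++⁻ (α ∷ U) sorted y∈ z∈)))
        (there ∘ E′⊆) C′⊆
    ; ascent-α = ascent-new α<z (ℕ.<⇒≤ α<z)
    }
    where
    open Labelled L
    sorted : AllPairs _<_ (α ∷ U ++ E′ ++ C′)
    sorted = subst (AllPairs _<_ ∘ (α ∷_)) eq upper-sorted
    z∈ : toℕ z ∈ E′ ++ C′
    z∈ = subst (_ ∈_) (sym eq′) (here refl)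
    α<z : α < toℕ z
    α<z = AllPairs-++⁻ (α ∷ U) sorted (here refl) z∈
    z≤ : ∀ {y} → y ∈ E′ ++ C′ → toℕ z ≤ y
    z≤ y∈ with subst (_ ∈_) eq′ y∈
    ... | here refl = ℕ.≤-refl
    ... | there y∈V =
      ℕ.<⇒≤ (AllPairs-∷⁻ (subst (AllPairs _<_) eq′ (AllPairs-++⁻ʳ (α ∷ U) sorted)) y∈V)

  E-child : ∀ {α A E₁ E₂ C} → Labelled f α A (E₁ ++ toℕ z ∷ E₂) C →
    Star g α A (map suc (toℕ z ∷ E₂)) (map suc C)
  E-child {E₁ = E₁} {E₂} {C} L =
    beyond-α (toℕ z ∷ E₂) C E₁ L (++-assoc E₁ (toℕ z ∷ E₂) C) (_ , refl) (∈-++⁺ʳ E₁) (λ x∈ → x∈)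

  C-child : ∀ {α A E C₁ C₂} → Labelled f α A E (C₁ ++ toℕ z ∷ C₂) →
    Star g α A [] (map suc (toℕ z ∷ C₂))
  C-child {E = E} {C₁} {C₂} L =
    beyond-α [] (toℕ z ∷ C₂) (E ++ C₁) L (sym (++-assoc E C₁ _)) (_ , refl) (λ ()) (∈-++⁺ʳ C₁)

  no-ascent-child : ¬ Ascent f 0 0 → toℕ z ≡ 0 → ¬ Ascent g 0 0
  no-ascent-child ¬asc z≡0 = [ ¬asc , (λ (0<z , _) → ℕ.<-irrefl (sym z≡0) 0<z) ] ∘ ascent⁻ (low z≤n) (low z≤n)

  -- Every ascent of the new word ends at the maximum, at position `z`. So none starts right of α,
  -- which gives the plain kind, and none reaches beyond the gaps above, which puts them all into
  -- `C`.
  first-ascent : ∀ {A C} → ¬ Ascent f 0 0 → 0 < toℕ z →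
    (∀ {y} → y ∈ A → y < toℕ z) → (∀ {y} → y < toℕ z → y ∈ A) → AllPairs _>_ A →
    (∀ {y} → y ∈ C → toℕ z ≤ y × y ≤ m) → (∀ {y} → toℕ z ≤ y → y ≤ m → y ∈ C) → AllPairs _<_ C →
    Plain g (toℕ z) A [] (map suc C)
  first-ascent {A} {C} ¬asc 0<z A< A⁺ sorted> C≥ C⁺ sorted< = record
    { labelled = child
        (λ { (here refl) → ℕ.≤-refl , free (Fin.toℕ≤pred[n] z) , ¬before
           ; (there y∈) →
               ℕ.<⇒≤ (A< y∈) , free (ℕ.≤-trans (ℕ.<⇒≤ (A< y∈)) (Fin.toℕ≤pred[n] z)) , ¬before })
        (λ y∈ → proj₁ (C≥ y∈) , free (proj₂ (C≥ y∈)) , inj₂ 0<z)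
        (λ y≤z _ _ → [ there ∘ A⁺ , here ]′ (ℕ.m≤n⇒m<n∨m≡n y≤z))
        (λ z≤y (y≤m , _) _ → C⁺ z≤y y≤m)
        (All.tabulate A< ∷ sorted>)
        sorted<
        (λ _ ())
        (λ _ → ¬ascent)
        (λ _ → ¬ascent)
    ; no-ascent-αα = [ ¬ascent , ℕ.<-irrefl refl ∘ proj₁ ] ∘ ascent⁻ (low ℕ.≤-refl) (low ℕ.≤-refl)
    ; α-positive = 0<z
    }
    where
    ¬ascent : ∀ {y x} → ¬ Ascent f y x
    ¬ascent = ¬asc ∘ ascent-antitone z≤n z≤n
    ¬before : ∀ {y} → ¬ AscentBefore f y
    ¬before (ascent i<j lt _) = ¬asc (ascent i<j lt z≤n z≤n)
    free : ∀ {y} → y ≤ m → Free f y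
    free y≤m = y≤m , λ where
      (p312 _ j<k x _ _ _) → ¬asc (ascent j<k x z≤n z≤n)
      (p123 i<j _ x _ _ _) → ¬asc (ascent i<j x z≤n z≤n)

-- Permutations as words

values : Vec (Fin n) m → Fin m → ℕ
values π i = toℕ (lookup π i)

Increasing-∷ : ∀ {x y} {v : Vec (Fin n) m} → x Fin.< y → Increasing (y ∷ v) → Increasing (x ∷ y ∷ v)
Increasing-∷ x<y inc zero    (suc zero)    _         = x<y
Increasing-∷ x<y inc zero    (suc (suc j)) _         = ℕ.<-trans x<y (inc zero (suc j) (s≤s z≤n))
Increasing-∷ x<y inc (suc i) (suc j)       (s≤s i<j) = inc i j i<j

increasing₄ : ∀ {a b c d : Fin n} → a Fin.< b → b Fin.< c → c Fin.< d →
  Increasing (a ∷ b ∷ c ∷ d ∷ [])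
increasing₄ a<b b<c c<d = Increasing-∷ a<b (Increasing-∷ b<c (Increasing-∷ c<d
  λ { zero zero () ; zero (suc ()) _ ; (suc ()) _ _ }))

increasing-cancel : ∀ (v : Vec (Fin n) m) → Increasing v → ∀ i j → lookup v i Fin.< lookup v j → i Fin.< j
increasing-cancel v inc i j lt with ℕ.<-cmp (toℕ i) (toℕ j)
... | tri< i<j _ _ = i<j
... | tri≈ _ i≡j _ =
  contradiction lt (ℕ.<-irrefl (cong (toℕ ∘ lookup v) (Fin.toℕ-injective i≡j)))
... | tri> _ _ j<i = contradiction lt (ℕ.<-asym (inc j i j<i))

-- q lists the positions in p by increasing letter, and r the rank of each letter.
contains : ∀ (π : Vec (Fin n) m) τ (p q : Vec (Fin m) (length τ)) (r : Vec (Fin (length τ)) (length τ)) →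
  Increasing p → Increasing (Vec.map (lookup π) q) → (∀ i → lookup p i ≡ lookup q (lookup r i)) →
  (∀ i j → lookup r i Fin.< lookup r j ⇔ lookupᴸ τ i < lookupᴸ τ j) → Contains π τ
contains π τ p q r inc-p inc-q sorted rank = p , inc-p , iso
  where
  letter : ∀ i → lookup (Vec.map (lookup π) p) i ≡ lookup (Vec.map (lookup π) q) (lookup r i)
  letter i = trans (lookup-map i (lookup π) p)
    (trans (cong (lookup π) (sorted i)) (sym (lookup-map (lookup r i) (lookup π) q)))

  iso : OrderIsomorphic τ (Vec.map (lookup π) p)
  iso i j rewrite letter i | letter j = mk⇔
    (Equivalence.to (rank i j) ∘ increasing-cancel (Vec.map (lookup π) q) inc-q (lookup r i) (lookup r j))
    (inc-q _ _ ∘ Equivalence.from (rank i j))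

pattern 0F = zero
pattern 1F = suc zero
pattern 2F = suc (suc zero)
pattern 3F = suc (suc (suc zero))

τ1243 τ3142 τ3412 : List ℕ
τ1243 = 1 ∷ 2 ∷ 4 ∷ 3 ∷ []
τ3142 = 3 ∷ 1 ∷ 4 ∷ 2 ∷ []
τ3412 = 3 ∷ 4 ∷ 1 ∷ 2 ∷ []

patterns : List (List ℕ)
patterns = τ1243 ∷ τ3142 ∷ τ3412 ∷ []

ranks? : ∀ τ (r : Vec (Fin (length τ)) (length τ)) → Dec
  (∀ i j → lookup r i Fin.< lookup r j ⇔ lookupᴸ τ i < lookupᴸ τ j)
ranks? τ r = Fin.all? λ i → Fin.all? λ j →
  (lookup r i Fin.<? lookup r j) ⇔-dec (lookupᴸ τ i ℕ.<? lookupᴸ τ j)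

avoids⁺ : (π : Vec (Fin n) m) → ¬ Forbidden (values π) → Avoids π patterns
avoids⁺ π ¬f = no-1243 ∷ no-3142 ∷ no-3412 ∷ []
  where
  1<2 : 1 < 2
  1<2 = s≤s (s≤s z≤n)
  2<3 : 2 < 3
  2<3 = s≤s 1<2
  3<4 : 3 < 4
  3<4 = s≤s 2<3

  no-1243 : ¬ Contains π τ1243
  no-1243 (i ∷ j ∷ k ∷ l ∷ [] , inc , iso) = ¬f
    (p1243 (inc 0F 1F (s≤s z≤n)) (inc 1F 2F 1<2) (inc 2F 3F 2<3)
      (Equivalence.from (iso 0F 1F) 1<2) (Equivalence.from (iso 1F 3F) 2<3) (Equivalence.from (iso 3F 2F) 3<4))

  no-3142 : ¬ Contains π τ3142
  no-3142 (i ∷ j ∷ k ∷ l ∷ [] , inc , iso) = ¬f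
    (p3142 (inc 0F 1F (s≤s z≤n)) (inc 1F 2F 1<2) (inc 2F 3F 2<3)
      (Equivalence.from (iso 1F 3F) 1<2) (Equivalence.from (iso 3F 0F) 2<3) (Equivalence.from (iso 0F 2F) 3<4))

  no-3412 : ¬ Contains π τ3412
  no-3412 (i ∷ j ∷ k ∷ l ∷ [] , inc , iso) = ¬f
    (p3412 (inc 0F 1F (s≤s z≤n)) (inc 1F 2F 1<2) (inc 2F 3F 2<3)
      (Equivalence.from (iso 2F 3F) 1<2) (Equivalence.from (iso 3F 0F) 2<3) (Equivalence.from (iso 0F 1F) 3<4))

avoids⁻ : (π : Vec (Fin n) m) → Avoids π patterns → ¬ Forbidden (values π)
avoids⁻ π (¬1243 ∷ _ ∷ _ ∷ []) (p1243 {i} {j} {k} {l} a b c x y w) =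
  ¬1243 (contains π τ1243 (i ∷ j ∷ k ∷ l ∷ []) (i ∷ j ∷ l ∷ k ∷ []) r
    (increasing₄ a b c) (increasing₄ x y w)
    (λ { 0F → refl ; 1F → refl ; 2F → refl ; 3F → refl }) (from-yes (ranks? τ1243 r)))
  where r = 0F ∷ 1F ∷ 3F ∷ 2F ∷ []
avoids⁻ π (_ ∷ ¬3142 ∷ _ ∷ []) (p3142 {i} {j} {k} {l} a b c x y w) =
  ¬3142 (contains π τ3142 (i ∷ j ∷ k ∷ l ∷ []) (j ∷ l ∷ i ∷ k ∷ []) r
    (increasing₄ a b c) (increasing₄ x y w)
    (λ { 0F → refl ; 1F → refl ; 2F → refl ; 3F → refl }) (from-yes (ranks? τ3142 r)))
  where r = 2F ∷ 0F ∷ 3F ∷ 1F ∷ []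
avoids⁻ π (_ ∷ _ ∷ ¬3412 ∷ []) (p3412 {i} {j} {k} {l} a b c x y w) =
  ¬3412 (contains π τ3412 (i ∷ j ∷ k ∷ l ∷ []) (k ∷ l ∷ i ∷ j ∷ []) r
    (increasing₄ a b c) (increasing₄ x y w)
    (λ { 0F → refl ; 1F → refl ; 2F → refl ; 3F → refl }) (from-yes (ranks? τ3412 r)))
  where r = 2F ∷ 3F ∷ 0F ∷ 1F ∷ []

-- Inserting and removing the largest letter of a permutation

insertMax : Vec (Fin n) n → Fin (suc n) → Vec (Fin (suc n)) (suc n)
insertMax π z = insertAt (Vec.map inject₁ π) z (fromℕ _)

lookup-new : ∀ (π : Vec (Fin n) n) z → lookup (insertMax π z) z ≡ fromℕ n
lookup-new π z = insertAt-lookup (Vec.map inject₁ π) z _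

lookup-old : ∀ (π : Vec (Fin n) n) z i → lookup (insertMax π z) (punchIn z i) ≡ inject₁ (lookup π i)
lookup-old π z i = trans (insertAt-punchIn (Vec.map inject₁ π) z _ i) (lookup-map i inject₁ π)

values-old : ∀ (π : Vec (Fin n) n) z i → values (insertMax π z) (punchIn z i) ≡ values π i
values-old π z i = trans (cong toℕ (lookup-old π z i)) (Fin.toℕ-inject₁ _)

values-new : ∀ (π : Vec (Fin n) n) z i → values π i < values (insertMax π z) z
values-new {n} π z i = subst (values π i <_) (sym (trans (cong toℕ (lookup-new π z)) (Fin.toℕ-fromℕ n)))
  (Fin.toℕ<n (lookup π i))

insertMax-avoids : ∀ (π : Vec (Fin n) n) z → ¬ Forbidden (values π) → ¬ Blocked (values π) (toℕ z) →
  ¬ Forbidden (values (insertMax π z))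
insertMax-avoids π z ¬f ¬b = [ ¬f , ¬b ]′ ∘ Insertion.forbidden⁻ _ _ z (values-old π z) (values-new π z)

insertMax-avoids⁻ : ∀ (π : Vec (Fin n) n) z → ¬ Forbidden (values (insertMax π z)) →
  ¬ Forbidden (values π) × ¬ Blocked (values π) (toℕ z)
insertMax-avoids⁻ π z ¬f = ¬f ∘ forbidden-old , ¬f ∘ blocked⇒forbidden
  where open Insertion (values π) (values (insertMax π z)) z (values-old π z) (values-new π z)

lookup-extensional : ∀ {A : Set} {v w : Vec A n} → lookup v ≗ lookup w → v ≡ w
lookup-extensional {v = v} {w} eq =
  trans (sym (tabulate∘lookup v)) (trans (tabulate-cong eq) (tabulate∘lookup w))

-- The place of the largest letter recovers the gap, and the remaining letters recover the word.
insertMax-injective : ∀ {π π′ : Vec (Fin n) n} {z z′} → insertMax π z ≡ insertMax π′ z′ → π ≡ π′ × z ≡ z′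
insertMax-injective {π = π} {π′} {z} {z′} eq with splitView z z′
... | new   = lookup-extensional (λ i → Fin.inject₁-injective
                (trans (sym (lookup-old π z i))
                (trans (cong (λ v → lookup v (punchIn z i)) eq) (lookup-old π′ z i)))) , refl
... | old i = contradiction (trans (sym (lookup-new π′ (punchIn z i)))
                (trans (cong (λ v → lookup v (punchIn z i)) (sym eq)) (lookup-old π z i))) Fin.fromℕ≢inject₁

isPermutation⁺ : ∀ (π : Vec (Fin n) n) z → IsPermutation π → IsPermutation (insertMax π z)
isPermutation⁺ π z (inj , surj) = inj′ , surj′
  where
  inj′ : ∀ {i j} → lookup (insertMax π z) i ≡ lookup (insertMax π z) j → i ≡ j
  inj′ {i} {j} eq with splitView z i | splitView z j
  ... | new   | new   = refl
  ... | new   | old j = contradiction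
    (trans (sym (lookup-new π z)) (trans eq (lookup-old π z j))) Fin.fromℕ≢inject₁
  ... | old i | new   = contradiction
    (trans (sym (lookup-new π z)) (trans (sym eq) (lookup-old π z i))) Fin.fromℕ≢inject₁
  ... | old i | old j = cong (punchIn z) (inj (Fin.inject₁-injective
                          (trans (sym (lookup-old π z i)) (trans eq (lookup-old π z j)))))
  surj′ : ∀ y → ∃ λ x → ∀ {i} → i ≡ x → lookup (insertMax π z) i ≡ y
  surj′ y with view y
  ... | ‵fromℕ     = z , λ { refl → lookup-new π z }
  ... | ‵inject₁ y = punchIn z (proj₁ (surj y)) ,
    λ { refl → trans (lookup-old π z _) (cong inject₁ (proj₂ (surj y) refl)) }

isPermutation⁻ : ∀ (π : Vec (Fin n) n) z → IsPermutation (insertMax π z) → IsPermutation π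
isPermutation⁻ π z (inj , surj) = inj′ , surj′
  where
  inj′ : ∀ {i j} → lookup π i ≡ lookup π j → i ≡ j
  inj′ {i} {j} eq = Fin.punchIn-injective z i j
    (inj (trans (lookup-old π z i) (trans (cong inject₁ eq) (sym (lookup-old π z j)))))
  surj′ : ∀ y → ∃ λ x → ∀ {i} → i ≡ x → lookup π i ≡ y
  surj′ y with surj (inject₁ y)
  ... | x , hit with splitView z x
  ...   | new   = contradiction (trans (sym (lookup-new π z)) (hit refl)) Fin.fromℕ≢inject₁
  ...   | old i = i , λ { refl → Fin.inject₁-injective (trans (sym (lookup-old π z i)) (hit refl)) }

removeMax : ∀ (σ : Vec (Fin (suc n)) (suc n)) → IsPermutation σ → ∃₂ λ π z → insertMax π z ≡ σ
removeMax {n} σ (inj , surj) with surj (fromℕ n)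
... | z , at-z = π , z , lookup-extensional same
  where
  -- By injectivity the largest letter occurs at `z` only, so the other letters fit into `Fin n`.
  not-max : ∀ i → n ≢ toℕ (lookup σ (punchIn z i))
  not-max i eq = Fin.punchInᵢ≢i z i (inj (trans
    (Fin.toℕ-injective (trans (sym eq) (sym (Fin.toℕ-fromℕ n)))) (sym (at-z refl))))
  π = tabulate λ i → lower₁ (lookup σ (punchIn z i)) (not-max i)
  same : lookup (insertMax π z) ≗ lookup σ
  same i with splitView z i
  ... | new   = trans (lookup-new π z) (sym (at-z refl))
  ... | old i = trans (lookup-old π z i)
    (trans (cong inject₁ (lookup∘tabulate _ i)) (Fin.inject₁-lower₁ _ (not-max i)))

-- Counting descendants

below : (ℕ → ℤ) → ℕ → ℤ
below h zero    = 0ℤ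
below h (suc k) = h k + below h k

-- star a c e d, plain a c e d and decreasing k d count the descendants after d insertions of a word
-- with the label (a , c , e) of the given kind, respectively of the decreasing word of length k.
star : ℕ → ℕ → ℕ → PowerSeries
star a c e zero    = 1ℤ
star a c e (suc d) =
  below (λ m → star m c 0 d) a + star a c e d
    + below (λ j → star a c (suc j) d) e + below (λ j → star a (suc j) 0 d) c

plain : ℕ → ℕ → ℕ → PowerSeries
plain a c e zero    = 1ℤ
plain a c e (suc d) =
  below (λ m → star m c 0 d) a + plain a c (suc e) d
    + below (λ j → star a c (suc j) d) e + below (λ j → star a (suc j) 0 d) c

-- The series Σᵢ xⁱ hᵢ.
diag : (ℕ → PowerSeries) → PowerSeries
diag h zero    = h 0 0
diag h (suc n) = h 0 (suc n) + diag (λ i → h (suc i)) n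

-- The share of the children of a decreasing word of length `k` that have an ascent. Its `k`
-- positive gaps give the labels with both entries positive and of sum `k + 1`.
split : ℕ → PowerSeries
split zero    d = 0ℤ
split (suc k) d = diag (λ a c → plain (suc a) (suc c) 0 d) k

decreasing : ℕ → PowerSeries
decreasing k zero    = 1ℤ
decreasing k (suc d) = decreasing (suc k) d + split k d

∑ : ∀ {A : Set} → (A → ℤ) → List A → ℤ
∑ f []       = 0ℤ
∑ f (x ∷ xs) = f x + ∑ f xs

module _ {A : Set} where

  ∑-cong : ∀ {f g : A → ℤ} xs → f ≗ g → ∑ f xs ≡ ∑ g xs
  ∑-cong []       eq = refl
  ∑-cong (x ∷ xs) eq = cong₂ _+_ (eq x) (∑-cong xs eq)

  ∑-++ : ∀ (f : A → ℤ) xs ys → ∑ f (xs ++ ys) ≡ ∑ f xs + ∑ f ys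
  ∑-++ f []       ys = sym (ℤ.+-identityˡ _)
  ∑-++ f (x ∷ xs) ys = trans (cong (_+_ (f x)) (∑-++ f xs ys)) (sym (ℤ.+-assoc (f x) _ _))

  ∑-map : ∀ {B : Set} (f : B → ℤ) (g : A → B) xs → ∑ f (map g xs) ≡ ∑ (f ∘ g) xs
  ∑-map f g []       = refl
  ∑-map f g (x ∷ xs) = cong (_+_ (f (g x))) (∑-map f g xs)

  ∑-↭ : ∀ (f : A → ℤ) {xs ys} → xs ↭ ys → ∑ f xs ≡ ∑ f ys
  ∑-↭ f ↭.refl         = refl
  ∑-↭ f (↭.prep x p)   = cong (_+_ (f x)) (∑-↭ f p)
  ∑-↭ f (↭.swap x y p) = trans (exchange (f x) (f y) _) (cong (λ s → f y + (f x + s)) (∑-↭ f p))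
    where
    exchange : ∀ a b c → a + (b + c) ≡ b + (a + c)
    exchange = solve-∀
  ∑-↭ f (↭.trans p q)  = trans (∑-↭ f p) (∑-↭ f q)

  ∑-1 : ∀ (xs : List A) → ∑ (λ _ → 1ℤ) xs ≡ + length xs
  ∑-1 []       = refl
  ∑-1 (x ∷ xs) = cong (_+_ 1ℤ) (∑-1 xs)

  -- Meant for lists of gaps: the label of a child depends only on how many gaps follow the chosen
  -- one in its list.
  ∑-suffixes : ∀ {f : A → ℤ} {h} xs → (∀ ys y zs → xs ≡ ys ++ y ∷ zs → f y ≡ h (length zs)) →
    ∑ f xs ≡ below h (length xs)
  ∑-suffixes []       eq = refl
  ∑-suffixes (x ∷ xs) eq = cong₂ _+_ (eq [] x xs refl)
    (∑-suffixes xs λ ys y zs xs≡ → eq (x ∷ ys) y zs (cong (x ∷_) xs≡))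

  Unique-↭ : ∀ {xs ys : List A} → Unique xs → Unique ys →
    (∀ {x} → x ∈ xs → x ∈ ys) → (∀ {x} → x ∈ ys → x ∈ xs) → xs ↭ ys
  Unique-↭ u v to from = ∼bag⇒↭ (unique∧set⇒bag u v (mk⇔ to from))

∑-applyUpTo : ∀ {A : Set} (ψ : A → ℤ) h (f : ℕ → A) k → (∀ a c → a ℕ.+ c ≡ k → ψ (f a) ≡ h a c) →
  ∑ ψ (applyUpTo f (suc k)) ≡ diag h k
∑-applyUpTo ψ h f zero    eq = trans (ℤ.+-identityʳ _) (eq 0 0 refl)
∑-applyUpTo ψ h f (suc k) eq = cong₂ _+_ (eq 0 (suc k) refl)
  (∑-applyUpTo ψ (λ a → h (suc a)) (f ∘ suc) k λ a c a+c≡k → eq (suc a) c (cong suc a+c≡k))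

-- Gaps beyond n go to n.
clamp : ℕ → Fin (suc n)
clamp {zero}  _       = zero
clamp {suc n} zero    = zero
clamp {suc n} (suc y) = suc (clamp y)

clamp-toℕ : (z : Fin (suc n)) → clamp (toℕ z) ≡ z
clamp-toℕ {zero}  zero    = refl
clamp-toℕ {suc n} zero    = refl
clamp-toℕ {suc n} (suc z) = cong suc (clamp-toℕ z)

toℕ-clamp : ∀ {y} → y ≤ n → toℕ (clamp {n} y) ≡ y
toℕ-clamp {zero}  z≤n       = refl
toℕ-clamp {suc n} z≤n       = refl
toℕ-clamp {suc n} (s≤s y≤n) = cong suc (toℕ-clamp y≤n)

opaque
  avoidsAfter? : ∀ ((π , z) : Vec (Fin n) n × Fin (suc n)) → Dec (Avoids (insertMax π z) patterns)
  avoidsAfter? (π , z) = avoids? (insertMax π z) patterns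

gaps : Vec (Fin n) n → List (Fin (suc n))
gaps {n} π = filter (λ z → avoidsAfter? (π , z)) (allFin (suc n))

descendants : ∀ (d : ℕ) → Vec (Fin n) n → ℤ
descendants zero    π = 1ℤ
descendants (suc d) π = ∑ (λ z → descendants d (insertMax π z)) (gaps π)

insertMaxℕ : Vec (Fin n) n → ℕ → Vec (Fin (suc n)) (suc n)
insertMaxℕ π y = insertMax π (clamp y)

child-avoids : ∀ (π : Vec (Fin n) n) {y} → ¬ Forbidden (values π) → Free (values π) y →
  ¬ Forbidden (values (insertMaxℕ π y))
child-avoids π {y} ¬f (y≤n , ¬b) = insertMax-avoids π (clamp y) ¬f
  (subst (¬_ ∘ Blocked (values π)) (sym (toℕ-clamp y≤n)) ¬b)

-- Lets the lists of a label replace `gaps`: the order of summation is irrelevant, and after a word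
-- without forbidden patterns the gaps that pass the filter are exactly the free ones.
descendants-suc : ∀ d (π : Vec (Fin n) n) L → ¬ Forbidden (values π) → Unique L →
  (∀ {y} → y ∈ L → Free (values π) y) → (∀ {y} → Free (values π) y → y ∈ L) →
  descendants (suc d) π ≡ ∑ (descendants d ∘ insertMaxℕ π) L
descendants-suc {n} d π L ¬f uniq sound complete = trans
  (∑-cong (gaps π) (λ z → cong (descendants d ∘ insertMax π) (sym (clamp-toℕ z))))
  (trans (sym (∑-map (descendants d ∘ insertMaxℕ π) toℕ (gaps π)))
  (∑-↭ _ (Unique-↭ (map⁺ Fin.toℕ-injective (filter⁺ avoids-after? (allFin⁺ (suc n)))) uniq to from)))
  where
  avoids-after? = λ z → avoidsAfter? (π , z)
  to : ∀ {y} → y ∈ map toℕ (gaps π) → y ∈ L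
  to y∈ with ∈-map⁻ toℕ y∈
  ... | z , z∈ , refl = complete (Fin.toℕ≤pred[n] z ,
          proj₂ (insertMax-avoids⁻ π z (avoids⁻ (insertMax π z)
            (proj₂ (∈-filter⁻ avoids-after? {xs = allFin (suc n)} z∈)))))
  from : ∀ {y} → y ∈ L → y ∈ map toℕ (gaps π)
  from {y} y∈ with sound y∈
  ... | y≤n , ¬b = subst (_∈ map toℕ (gaps π)) (toℕ-clamp y≤n)
          (∈-map⁺ toℕ (∈-filter⁺ avoids-after? (∈-allFin (clamp y))
            (avoids⁺ (insertMaxℕ π y) (child-avoids π ¬f (y≤n , ¬b)))))

private
  module At {n} (π : Vec (Fin n) n) (z : Fin (suc n)) =
    Children (values π) (values (insertMax π z)) z (values-old π z) (values-new π z)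

module _ (π : Vec (Fin n) n) {α A E C}
  (L : Labelled (values π) α A E C) (¬f : ¬ Forbidden (values π)) where
  open Labelled L

  descendants-labelled : ∀ d → let ψ = descendants d ∘ insertMaxℕ π in
    descendants (suc d) π ≡ ∑ ψ A + ψ α + ∑ ψ E + ∑ ψ C
  descendants-labelled d = trans
    (descendants-suc d π ((α ∷ A) ++ (E ++ C)) ¬f
      (++⁺ (AllPairs.map (λ gt → ℕ.<⇒≢ gt ∘ sym) lower-sorted)
           (AllPairs.map ℕ.<⇒≢ (AllPairs.tail upper-sorted))
           λ (y∈ , y∈′) → ℕ.<⇒≱ (AllPairs-∷⁻ upper-sorted y∈′) (≤α y∈))
      ([ lower-free , upper-free ]′ ∘ ∈-++⁻ (α ∷ A))
      ([ ∈-++⁺ˡ , ∈-++⁺ʳ (α ∷ A) ]′ ∘ complete))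
    (trans (∑-++ ψ (α ∷ A) (E ++ C))
    (trans (cong (_+_ (ψ α + ∑ ψ A)) (∑-++ ψ E C)) (rearrange (ψ α) (∑ ψ A) (∑ ψ E) (∑ ψ C))))
    where
    ψ = descendants d ∘ insertMaxℕ π
    ≤α : ∀ {y} → y ∈ α ∷ A → y ≤ α
    ≤α (here refl) = ℕ.≤-refl
    ≤α (there y∈)  = ℕ.<⇒≤ (AllPairs-∷⁻ lower-sorted y∈)
    rearrange : ∀ a b c d → a + b + (c + d) ≡ b + a + c + d
    rearrange = solve-∀

-- Induction on `d`, mutual with the lemmas on single children: each child is again a star, with one
-- insertion fewer to come.
descendants-star : ∀ d (π : Vec (Fin n) n) {α A E C} → Star (values π) α A E C →
  ¬ Forbidden (values π) → descendants d π ≡ star (length A) (length C) (length E) d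

lower-descendants : ∀ d (π : Vec (Fin n) n) {α A E C} ys y zs → A ≡ ys ++ y ∷ zs →
  Labelled (values π) α A E C → ¬ Forbidden (values π) →
  descendants d (insertMaxℕ π y) ≡ star (length zs) (length C) 0 d
lower-descendants d π {C = C} ys y zs refl L ¬f = subst
  (λ c → descendants d (insertMaxℕ π y) ≡ star (length zs) c 0 d) (length-map suc C)
  (descendants-star d (insertMaxℕ π y) (At.lower-child π (clamp y) {A₁ = ys}
      (subst (λ y → Labelled _ _ (ys ++ y ∷ zs) _ C) (sym (toℕ-clamp (proj₁ free))) L))
    (child-avoids π ¬f free))
  where free = Labelled.lower-free L (there (∈-++⁺ʳ ys (here refl)))

E-descendants : ∀ d (π : Vec (Fin n) n) {α A E C} ys y zs → E ≡ ys ++ y ∷ zs →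
  Labelled (values π) α A E C → ¬ Forbidden (values π) →
  descendants d (insertMaxℕ π y) ≡ star (length A) (length C) (suc (length zs)) d
E-descendants d π {A = A} {C = C} ys y zs refl L ¬f = subst₂
  (λ c e → descendants d (insertMaxℕ π y) ≡ star (length A) c (suc e) d)
  (length-map suc C) (length-map suc zs)
  (descendants-star d (insertMaxℕ π y) (At.E-child π (clamp y) {E₁ = ys}
      (subst (λ y → Labelled _ _ A (ys ++ y ∷ zs) C) (sym (toℕ-clamp (proj₁ free))) L))
    (child-avoids π ¬f free))
  where free = Labelled.upper-free L (∈-++⁺ˡ (∈-++⁺ʳ ys (here refl)))

C-descendants : ∀ d (π : Vec (Fin n) n) {α A E C} ys y zs → C ≡ ys ++ y ∷ zs →
  Labelled (values π) α A E C → ¬ Forbidden (values π) →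
  descendants d (insertMaxℕ π y) ≡ star (length A) (suc (length zs)) 0 d
C-descendants d π {A = A} {E} ys y zs refl L ¬f = subst
  (λ c → descendants d (insertMaxℕ π y) ≡ star (length A) (suc c) 0 d) (length-map suc zs)
  (descendants-star d (insertMaxℕ π y) (At.C-child π (clamp y) {C₁ = ys}
      (subst (λ y → Labelled _ _ A E (ys ++ y ∷ zs)) (sym (toℕ-clamp (proj₁ free))) L))
    (child-avoids π ¬f free))
  where free = Labelled.upper-free L (∈-++⁺ʳ E (∈-++⁺ʳ ys (here refl)))

descendants-label : ∀ d (π : Vec (Fin n) n) {α A E C} →
  Labelled (values π) α A E C → ¬ Forbidden (values π) →
  descendants (suc d) π
    ≡ below (λ a → star a (length C) 0 d) (length A) + descendants d (insertMaxℕ π α)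
      + below (λ e → star (length A) (length C) (suc e) d) (length E)
      + below (λ c → star (length A) (suc c) 0 d) (length C)
descendants-label d π {α} {A} {E} {C} L ¬f = trans (descendants-labelled π L ¬f d)
  (cong₂ _+_ (cong₂ _+_ (cong (_+ descendants d (insertMaxℕ π α))
    (∑-suffixes A λ ys y zs eq → lower-descendants d π ys y zs eq L ¬f))
    (∑-suffixes E λ ys y zs eq → E-descendants d π ys y zs eq L ¬f))
    (∑-suffixes C λ ys y zs eq → C-descendants d π ys y zs eq L ¬f))

descendants-star zero    π S ¬f = refl
descendants-star (suc d) π {α} {A} {E} {C} S ¬f = trans (descendants-label d π labelled ¬f)
  (cong₂ _+_ (cong₂ _+_ (cong (_+_ (below (λ a → star a (length C) 0 d) (length A))) at-α) refl) refl)
  where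
  open Star S
  free = lower-free (here refl)
  at-α : descendants d (insertMaxℕ π α) ≡ star (length A) (length C) (length E) d
  at-α = subst₂ (λ c e → descendants d (insertMaxℕ π α) ≡ star (length A) c e d)
    (length-map suc C) (length-map suc E)
    (descendants-star d (insertMaxℕ π α)
      (At.star-at-α π (clamp α) (subst (λ y → Star _ y A E C) (sym (toℕ-clamp (proj₁ free))) S))
      (child-avoids π ¬f free))

descendants-plain : ∀ d (π : Vec (Fin n) n) {α A E C} → Plain (values π) α A E C →
  ¬ Forbidden (values π) → descendants d π ≡ plain (length A) (length C) (length E) d
descendants-plain zero    π S ¬f = refl
descendants-plain (suc d) π {α} {A} {E} {C} S ¬f = trans (descendants-label d π labelled ¬f)
  (cong₂ _+_ (cong₂ _+_ (cong (_+_ (below (λ a → star a (length C) 0 d) (length A))) at-α) refl) refl)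
  where
  open Plain S
  free = lower-free (here refl)
  at-α : descendants d (insertMaxℕ π α) ≡ plain (length A) (length C) (suc (length E)) d
  at-α = subst₂ (λ c e → descendants d (insertMaxℕ π α) ≡ plain (length A) c (suc e) d)
    (length-map suc C) (length-map suc E)
    (descendants-plain d (insertMaxℕ π α)
      (At.plain-at-α π (clamp α) (subst (λ y → Plain _ y A E C) (sym (toℕ-clamp (proj₁ free))) S))
      (child-avoids π ¬f free))

-- Every pattern contains an ascent, so all gaps are free. The gap 0 keeps the word decreasing and
-- any other gap creates the first ascent.
descendants-decreasing : ∀ d (π : Vec (Fin n) n) → ¬ Ascent (values π) 0 0 →
  descendants d π ≡ decreasing n d
descendants-decreasing     zero    π ¬asc = refl
descendants-decreasing {n} (suc d) π ¬asc = trans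
  (descendants-suc d π (upTo (suc n)) ¬f (upTo⁺ (suc n)) (free ∘ ℕ.≤-pred ∘ ∈-upTo⁻) (∈-upTo⁺ ∘ s≤s ∘ proj₁))
  (cong₂ _+_
    (descendants-decreasing d (insertMaxℕ π 0) (At.no-ascent-child π (clamp 0) ¬asc (toℕ-clamp {n} z≤n)))
    (positive n π ¬asc ¬f free))
  where
  ¬f : ¬ Forbidden (values π)
  ¬f (p1243 i<j _ _ x _ _) = ¬asc (ascent i<j x z≤n z≤n)
  ¬f (p3142 _ j<k _ x y w) = ¬asc (ascent j<k (ℕ.<-trans x (ℕ.<-trans y w)) z≤n z≤n)
  ¬f (p3412 _ _ k<l x _ _) = ¬asc (ascent k<l x z≤n z≤n)
  free : ∀ {y} → y ≤ n → Free (values π) y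
  free y≤n = y≤n , λ where
    (p312 _ j<k x _ _ _) → ¬asc (ascent j<k x z≤n z≤n)
    (p123 i<j _ x _ _ _) → ¬asc (ascent i<j x z≤n z≤n)

  positive : ∀ n (π : Vec (Fin n) n) → ¬ Ascent (values π) 0 0 → ¬ Forbidden (values π) →
    (∀ {y} → y ≤ n → Free (values π) y) →
    ∑ (descendants d ∘ insertMaxℕ π) (applyUpTo suc n) ≡ split n d
  positive zero    π ¬asc ¬f free = refl
  positive (suc k) π ¬asc ¬f free =
    ∑-applyUpTo (descendants d ∘ insertMaxℕ π) (λ a c → plain (suc a) (suc c) 0 d) ℕ.suc k first
    where
    first : ∀ a c → a ℕ.+ c ≡ k → descendants d (insertMaxℕ π (suc a)) ≡ plain (suc a) (suc c) 0 d
    first a c refl = subst₂ (λ a′ c′ → descendants d (insertMaxℕ π (suc a)) ≡ plain a′ c′ 0 d)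
      (length-downFrom (suc a)) (trans (length-map suc above) (length-applyUpTo (suc a ℕ.+_) (suc c)))
      (descendants-plain d (insertMaxℕ π (suc a))
        (At.first-ascent π (clamp (suc a)) {A = downFrom (suc a)} {C = above} ¬asc
          (subst (0 <_) (sym z≡) (s≤s z≤n))
          (λ {y} y∈ → subst (y <_) (sym z≡) (∈-downFrom⁻ y∈))
          (λ {y} y<z → ∈-downFrom⁺ (subst (y <_) z≡ y<z))
          (AllPairs.applyDownFrom⁺₁ id (suc a) λ j<i _ → j<i)
          (λ y∈ → let i , i<c , eq = ∈-applyUpTo⁻ (suc a ℕ.+_) y∈ in
             subst₂ _≤_ (sym z≡) (sym eq) (ℕ.m≤m+n (suc a) i)
             , subst (_≤ _) (sym eq) (s≤s (ℕ.+-monoʳ-≤ a (ℕ.≤-pred i<c))))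
          (λ {y} z≤y y≤ → let a<y = subst (_≤ y) z≡ z≤y in
             subst (_∈ above) (ℕ.m+[n∸m]≡n a<y)
               (∈-applyUpTo⁺ (suc a ℕ.+_) (s≤s (ℕ.≤-trans
                 (ℕ.∸-monoˡ-≤ (suc a) y≤) (ℕ.≤-reflexive (ℕ.m+n∸m≡n a c))))))
          (AllPairs.applyUpTo⁺₁ (suc a ℕ.+_) (suc c) λ i<j _ → ℕ.+-monoʳ-< (suc a) i<j))
        (child-avoids π ¬f (free a≤)))
      where
      above = applyUpTo (suc a ℕ.+_) (suc c)
      a≤ : suc a ≤ suc (a ℕ.+ c)
      a≤ = s≤s (ℕ.m≤m+n a c)
      z≡ : toℕ (clamp {suc (a ℕ.+ c)} (suc a)) ≡ suc a
      z≡ = toℕ-clamp a≤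

-- From descendants to the number of avoiders

∑-filter-product : ∀ {A B : Set} {P : A × B → Set} (P? : ∀ p → Dec (P p)) (f : A × B → ℤ) xs ys →
  ∑ f (filter P? (cartesianProduct xs ys)) ≡ ∑ (λ x → ∑ (λ y → f (x , y)) (filter (λ y → P? (x , y)) ys)) xs
∑-filter-product P? f []       ys = refl
∑-filter-product P? f (x ∷ xs) ys = row ys
  where
  rest = cartesianProduct xs ys
  row : ∀ zs → ∑ f (filter P? (map (x ,_) zs ++ rest))
    ≡ ∑ (λ y → f (x , y)) (filter (λ y → P? (x , y)) zs)
      + ∑ (λ x → ∑ (λ y → f (x , y)) (filter (λ y → P? (x , y)) ys)) xs
  row []       = trans (∑-filter-product P? f xs ys) (sym (ℤ.+-identityˡ _))
  row (z ∷ zs) with P? (x , z)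
  ... | yes _ = trans (cong (_+_ (f (x , z))) (row zs)) (sym (ℤ.+-assoc (f (x , z)) _ _))
  ... | no  _ = row zs

S-suc : ∀ n → S (suc n) patterns ↭ map (uncurry insertMax)
  (filter avoidsAfter? (cartesianProduct (S n patterns) (allFin (suc n))))
S-suc n = Unique-↭ (S-unique (suc n) patterns)
  (map⁺ (λ eq → let π≡ , z≡ = insertMax-injective eq in cong₂ _,_ π≡ z≡)
    (filter⁺ avoidsAfter? (cartesianProduct⁺ (S-unique n patterns) (allFin⁺ (suc n)))))
  to from
  where
  pairs = cartesianProduct (S n patterns) (allFin (suc n))
  inserted = map (uncurry insertMax) (filter avoidsAfter? pairs)

  insertMax∈ : ∀ π z → IsPermutation (insertMax π z) → Avoids (insertMax π z) patterns →
    insertMax π z ∈ inserted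
  insertMax∈ π z perm av = ∈-map⁺ (uncurry insertMax) (∈-filter⁺ avoidsAfter? (∈-cartesianProduct⁺
    (Equivalence.from (∈-S patterns π)
      (isPermutation⁻ π z perm , avoids⁺ π (proj₁ (insertMax-avoids⁻ π z (avoids⁻ (insertMax π z) av)))))
    (∈-allFin z)) av)

  to : ∀ {σ} → σ ∈ S (suc n) patterns → σ ∈ inserted
  to {σ} σ∈ =
    let perm , av = Equivalence.to (∈-S patterns σ) σ∈
        π , z , eq = removeMax σ perm
    in subst (_∈ inserted) eq (insertMax∈ π z (subst IsPermutation (sym eq) perm)
         (subst (λ σ → Avoids σ patterns) (sym eq) av))

  from : ∀ {σ} → σ ∈ inserted → σ ∈ S (suc n) patterns
  from {σ} σ∈ =
    let (π , z) , p∈ , eq = ∈-map⁻ (uncurry insertMax) σ∈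
        p∈′ , av = ∈-filter⁻ avoidsAfter? {xs = pairs} p∈
        perm , _ = Equivalence.to (∈-S patterns π)
          (proj₁ (∈-cartesianProduct⁻ (S n patterns) (allFin (suc n)) p∈′))
    in Equivalence.from (∈-S patterns σ)
         (subst IsPermutation (sym eq) (isPermutation⁺ π z perm)
         , subst (λ σ → Avoids σ patterns) (sym eq) av)

-- The generalisation to `d` allows induction on `n`: the last insertion is moved from the
-- permutations to their descendants, until only the empty word is left, decreasing of length 0.
∑-S : ∀ n d → ∑ (descendants d) (S n patterns) ≡ decreasing 0 (n ℕ.+ d)
∑-S zero    d = trans (ℤ.+-identityʳ _) (descendants-decreasing d [] λ { (ascent {()} _ _ _ _) })
∑-S (suc n) d = trans (∑-↭ (descendants d) (S-suc n))
  (trans (∑-map (descendants d) (uncurry insertMax)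
    (filter avoidsAfter? (cartesianProduct (S n patterns) (allFin (suc n)))))
  (trans (∑-filter-product avoidsAfter? (descendants d ∘ uncurry insertMax) (S n patterns) (allFin (suc n)))
  (trans (∑-S n (suc d)) (cong (decreasing 0) (ℕ.+-suc n d)))))

F-eq : F patterns ≗ decreasing 0
F-eq n = trans (sym (∑-1 (S n patterns))) (trans (∑-S n 0) (cong (decreasing 0) (ℕ.+-identityʳ n)))

-- Generating functions

X : PowerSeries → PowerSeries
X f zero    = 0ℤ
X f (suc n) = f n

X-cong : ∀ {f g} → f ≗ g → X f ≗ X g
X-cong eq zero    = refl
X-cong eq (suc n) = eq n

diag-cong : ∀ {g h : ℕ → PowerSeries} → (∀ i → g i ≗ h i) → diag g ≗ diag h
diag-cong eq zero    = eq 0 0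
diag-cong eq (suc n) = cong₂ _+_ (eq 0 (suc n)) (diag-cong (λ i → eq (suc i)) n)

diag-+ : ∀ g h n → diag (λ i j → g i j + h i j) n ≡ diag g n + diag h n
diag-+ g h zero    = refl
diag-+ g h (suc n) = trans
  (cong (_+_ (g 0 (suc n) + h 0 (suc n))) (diag-+ (λ i → g (suc i)) (λ i → h (suc i)) n))
  (interchange (g 0 (suc n)) (h 0 (suc n)) _ _)
  where
  interchange : ∀ a b c d → (a + b) + (c + d) ≡ (a + c) + (b + d)
  interchange = solve-∀

diag-* : ∀ k h n → diag (λ i j → k * h i j) n ≡ k * diag h n
diag-* k h zero    = refl
diag-* k h (suc n) = trans (cong (_+_ (k * h 0 (suc n))) (diag-* k (λ i → h (suc i)) n))
  (sym (ℤ.*-distribˡ-+ k _ _))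

diag-peel : ∀ h n → diag h n ≡ h 0 n + X (diag (λ i → h (suc i))) n
diag-peel h zero    = sym (ℤ.+-identityʳ _)
diag-peel h (suc n) = refl

diag-X : ∀ h → diag (λ i → X (h i)) ≗ X (diag h)
diag-X h zero    = refl
diag-X h (suc n) = trans (cong (_+_ (h 0 n)) (diag-X (λ i → h (suc i)) n)) (sym (diag-peel h n))

-- Both sides sum `g a c d` over `a + c + d = n`, grouped differently.
diag-assoc : ∀ (g : ℕ → ℕ → PowerSeries) n →
  diag (λ k d → diag (λ a c → g a c d) k) n ≡ diag (λ a → diag (g a)) n
diag-assoc g zero    = refl
diag-assoc g (suc n) = trans
  (cong (_+_ (g 0 0 (suc n))) (trans
    (diag-+ (λ k → g 0 (suc k)) (λ k d → diag (λ a c → g (suc a) c d) k) n)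
    (cong (_+_ (diag (λ c → g 0 (suc c)) n)) (diag-assoc (λ a → g (suc a)) n))))
  (sym (ℤ.+-assoc (g 0 0 (suc n)) _ _))

partialSums : (ℕ → PowerSeries) → ℕ → PowerSeries
partialSums h k j = below (λ i → h i j) (suc k)

-- Partial sums amount to division by 1-x.
diag-partialSums : ∀ h n → diag (partialSums h) n ≡ diag h n + X (diag (partialSums h)) n
diag-partialSums h n = trans (diag-+ h (λ k j → below (λ i → h i j) k) n)
  (cong (_+_ (diag h n)) (trans (diag-peel (λ k j → below (λ i → h i j) k) n) (ℤ.+-identityˡ _)))

diag-zero : ∀ n → diag (λ _ _ → 0ℤ) n ≡ 0ℤ
diag-zero zero    = refl
diag-zero (suc n) = trans (ℤ.+-identityˡ _) (diag-zero n)

below-diag : ∀ (g : ℕ → ℕ → PowerSeries) k n →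
  diag (λ c j → below (λ i → g i c j) k) n ≡ below (λ i → diag (g i) n) k
below-diag g zero    n = diag-zero n
below-diag g (suc k) n = trans (diag-+ (g k) (λ c j → below (λ i → g i c j) k) n)
  (cong (_+_ (diag (g k) n)) (below-diag g k n))

-- (1 - 2x) star (e + 1) = (1 - x) star e
star-suc : ∀ a c e d → star a c (suc e) (suc d)
  ≡ star a c e (suc d) - star a c e d + (star a c (suc e) d + star a c (suc e) d)
star-suc a c e d = lemma (below (λ m → star m c 0 d) a) (star a c e d) (star a c (suc e) d)
  (below (λ j → star a c (suc j) d) e) (below (λ j → star a (suc j) 0 d) c)
  where
  lemma : ∀ p s s′ q r → p + s′ + (s′ + q) + r ≡ p + s + q + r - s + (s′ + s′)
  lemma = solve-∀

plain-suc : ∀ a c e d →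
  plain a c e (suc d) ≡ star a c e (suc d) - star a c e d + plain a c (suc e) d
plain-suc a c e d = lemma (below (λ m → star m c 0 d) a) (star a c e d) (plain a c (suc e) d)
  (below (λ j → star a c (suc j) d) e) (below (λ j → star a (suc j) 0 d) c)
  where
  lemma : ∀ p s s′ q r → p + s′ + q + r ≡ p + s + q + r - s + s′
  lemma = solve-∀

-- u ≗ rhs u v says (1 - 3x + x²) u = (1 - x)(1 - 2x) v.
rhs : PowerSeries → PowerSeries → PowerSeries
rhs u v n = + 3 * X u n + - + 1 * X (X u) n + (v n + - + 3 * X v n + + 2 * X (X v) n)

-- Multiply Pₑ = (1-x) Sₑ + x Pₑ₊₁ by 1-3x+x² and use the claim for e + 1, then (1-2x) Sₑ₊₁ = (1-x)
-- Sₑ; it remains that (1-3x+x²) + x(1-x) = 1-2x. Although e rises, the factor x lowers the degree,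
-- on which the induction runs.
plain-rec : ∀ a c e d → plain a c e (suc (suc d)) ≡ rhs (plain a c e) (star a c e) (suc (suc d))
plain-rec a c e zero = lemma (p 2) (p 1) (plain a c (suc e) 1) (s 2) (s 1) (star a c (suc e) 1)
  (plain-suc a c e 1) (plain-suc a c e 0) (plain-suc a c (suc e) 0) (star-suc a c e 0)
  where
  p = plain a c e
  s = star a c e
  lemma : ∀ p₂ p₁ q₁ s₂ s₁ t₁ → p₂ ≡ s₂ - s₁ + q₁ → p₁ ≡ s₁ - 1ℤ + 1ℤ → q₁ ≡ t₁ - 1ℤ + 1ℤ →
    t₁ ≡ s₁ - 1ℤ + (1ℤ + 1ℤ) → p₂ ≡ + 3 * p₁ + - + 1 * 1ℤ + (s₂ + - + 3 * s₁ + + 2 * 1ℤ)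
  lemma _ _ _ s₂ s₁ _ refl refl refl refl = identity s₂ s₁
    where
    identity : ∀ s₂ s₁ → s₂ - s₁ + (s₁ - 1ℤ + (1ℤ + 1ℤ) - 1ℤ + 1ℤ)
      ≡ + 3 * (s₁ - 1ℤ + 1ℤ) + - + 1 * 1ℤ + (s₂ + - + 3 * s₁ + + 2 * 1ℤ)
    identity = solve-∀
plain-rec a c e (suc d) = lemma (p (suc (suc (suc d)))) (p (suc (suc d))) (p (suc d))
  (q (suc (suc d))) (q (suc d)) (q d) (s (suc (suc (suc d)))) (s (suc (suc d))) (s (suc d)) (s d)
  (t (suc (suc d))) (t (suc d)) (t d)
  (plain-suc a c e (suc (suc d))) (plain-suc a c e (suc d)) (plain-suc a c e d)
  (plain-rec a c (suc e) d) (star-suc a c e (suc d)) (star-suc a c e d)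
  where
  p = plain a c e
  q = plain a c (suc e)
  s = star a c e
  t = star a c (suc e)
  lemma : ∀ p₃ p₂ p₁ q₂ q₁ q₀ s₃ s₂ s₁ s₀ t₂ t₁ t₀ →
    p₃ ≡ s₃ - s₂ + q₂ → p₂ ≡ s₂ - s₁ + q₁ → p₁ ≡ s₁ - s₀ + q₀ →
    q₂ ≡ + 3 * q₁ + - + 1 * q₀ + (t₂ + - + 3 * t₁ + + 2 * t₀) →
    t₂ ≡ s₂ - s₁ + (t₁ + t₁) → t₁ ≡ s₁ - s₀ + (t₀ + t₀) →
    p₃ ≡ + 3 * p₂ + - + 1 * p₁ + (s₃ + - + 3 * s₂ + + 2 * s₁)
  lemma _ _ _ _ q₁ q₀ s₃ s₂ s₁ s₀ _ _ t₀ refl refl refl refl refl refl =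
    identity q₁ q₀ s₃ s₂ s₁ s₀ t₀
    where
    identity : ∀ q₁ q₀ s₃ s₂ s₁ s₀ t₀ →
      s₃ - s₂ + (+ 3 * q₁ + - + 1 * q₀ + (s₂ - s₁ + (s₁ - s₀ + (t₀ + t₀) + (s₁ - s₀ + (t₀ + t₀)))
        + - + 3 * (s₁ - s₀ + (t₀ + t₀)) + + 2 * t₀))
      ≡ + 3 * (s₂ - s₁ + q₁) + - + 1 * (s₁ - s₀ + q₀) + (s₃ + - + 3 * s₂ + + 2 * s₁)
    identity = solve-∀

plain-rhs : ∀ a c e → plain a c e ≗ rhs (plain a c e) (star a c e)
plain-rhs a c e 0 = refl
plain-rhs a c e 1 = trans (plain-suc a c e 0) (lemma (star a c e 1))
  where
  lemma : ∀ s → s - 1ℤ + 1ℤ ≡ + 3 * 1ℤ + - + 1 * 0ℤ + (s + - + 3 * 1ℤ + + 2 * 0ℤ)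
  lemma = solve-∀
plain-rhs a c e (suc (suc d)) = plain-rec a c e d

diag-*X : ∀ k h n → diag (λ i j → k * X (h i) j) n ≡ k * X (diag h) n
diag-*X k h n = trans (diag-* k (λ i → X (h i)) n) (cong (k *_) (diag-X h n))

diag-*XX : ∀ k h n → diag (λ i j → k * X (X (h i)) j) n ≡ k * X (X (diag h)) n
diag-*XX k h n = trans (diag-*X k (λ i → X (h i)) n) (cong (k *_) (X-cong (diag-X h) n))

-- The equation is linear with coefficients independent of `i`, so it passes to the weighted sum.
diag-rhs : ∀ u v → (∀ i → u i ≗ rhs (u i) (v i)) → diag u ≗ rhs (diag u) (diag v)
diag-rhs u v eq n =
  trans (diag-cong eq n) (
  trans (diag-+ (λ i j → + 3 * X (u i) j + - + 1 * X (X (u i)) j) _ n) (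
  cong₂ _+_
    (trans (diag-+ (λ i j → + 3 * X (u i) j) _ n)
      (cong₂ _+_ (diag-*X (+ 3) u n) (diag-*XX (- + 1) u n)))
    (trans (diag-+ (λ i j → v i j + - + 3 * X (v i) j) _ n) (cong₂ _+_
      (trans (diag-+ v _ n) (cong (_+_ (diag v n)) (diag-*X (- + 3) v n)))
      (diag-*XX (+ 2) v n)))))

total : (ℕ → ℕ → PowerSeries) → PowerSeries
total g = diag (λ a → diag (g a))

-- Both indices are shifted to start at 0: these are the sums of xᵃ⁺ᶜ⁻² Pₐ꜀₀ and xᵃ⁺ᶜ⁻² Sₐ꜀₀ over a,
-- c ≥ 1.
φ β : PowerSeries
φ = total λ a c → plain (suc a) (suc c) 0
β = total λ a c → star (suc a) (suc c) 0

φ-rec : φ ≗ rhs φ β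
φ-rec = diag-rhs _ _ λ a → diag-rhs _ _ λ c → plain-rhs (suc a) (suc c) 0

-- Only c is shifted. The descendants of a star with e = 0 and c ≥ 1 keep these properties, but a
-- may drop to 0, so the row a = 0 has to be included and removed later.
σ : ℕ → ℕ → PowerSeries
σ a c = star a (suc c) 0

δ : PowerSeries
δ = poly (1ℤ ∷ [])

-- The child at α has the label of its parent and completes the sum over the smaller values of a to
-- a partial sum.
σ-eq : ∀ a c n → σ a c n ≡ δ n + (X (partialSums (λ i → σ i c) a) n + X (partialSums (σ a) c) n)
σ-eq a c zero    = refl
σ-eq a c (suc d) = lemma (below (λ m → star m (suc c) 0 d) a) (star a (suc c) 0 d) _
  where
  lemma : ∀ p s q → p + s + + 0 + q ≡ + 0 + (s + p + q)
  lemma = solve-∀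

diag-δ : ∀ n → diag (λ _ → δ) n ≡ 1ℤ
diag-δ zero    = refl
diag-δ (suc n) = trans (ℤ.+-identityˡ _) (diag-δ n)

diag-1 : ∀ n → diag (λ _ _ → 1ℤ) n ≡ + suc n
diag-1 zero    = refl
diag-1 (suc n) = cong (_+_ 1ℤ) (diag-1 n)

diag-σ : ∀ a n → diag (σ a) n ≡
  1ℤ + (X (partialSums (λ i → diag (σ i)) a) n + X (diag (partialSums (σ a))) n)
diag-σ a n =
  trans (diag-cong (σ-eq a) n) (
  trans (diag-+ (λ _ → δ) _ n) (
  cong₂ _+_ (diag-δ n) (
  trans (diag-+ (λ c → X (partialSums (λ i → σ i c) a)) _ n) (
  cong₂ _+_ (trans (diag-X (λ c → partialSums (λ i → σ i c) a) n)
              (X-cong (below-diag σ (suc a)) n))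
            (diag-X (partialSums (σ a)) n)))))

-- edge is 1/(1 - 3x + x²) and full is 1/((1 - x)(1 - 3x)).
edge full partialRows partialColumns : PowerSeries
edge = diag (σ 0)
full = total σ
partialRows = diag (partialSums (λ a → diag (σ a)))
partialColumns = total λ a → partialSums (σ a)

-- For a = 0 the rule reads E = 1/(1-x) + x (E + E/(1-x)), and (1-x)² - x = 1-3x+x².
edge-rec : ∀ n → edge (suc (suc n)) ≡ + 3 * edge (suc n) - edge n
edge-rec n = lemma (edge (suc (suc n))) (edge (suc n)) (edge n) _ _
  (diag-σ 0 (suc (suc n))) (diag-σ 0 (suc n)) (diag-partialSums (σ 0) (suc n))
  where
  lemma : ∀ r₂ r₁ r₀ v₁ v₀ → r₂ ≡ 1ℤ + (r₁ + + 0 + v₁) → r₁ ≡ 1ℤ + (r₀ + + 0 + v₀) → v₁ ≡ r₁ + v₀ →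
    r₂ ≡ + 3 * r₁ - r₀
  lemma _ _ r₀ _ v₀ refl refl refl = identity r₀ v₀
    where
    identity : ∀ r₀ v₀ → 1ℤ + (1ℤ + (r₀ + + 0 + v₀) + + 0 + (1ℤ + (r₀ + + 0 + v₀) + v₀))
      ≡ + 3 * (1ℤ + (r₀ + + 0 + v₀)) - r₀
    identity = solve-∀

-- Summing over rows and over columns both divide by 1-x, so this is G = 1/(1-x)² + 2xG/(1-x),
-- whence G = 1/((1-x)(1-3x)).
full-eq : ∀ n → full n ≡ + suc n + (X partialRows n + X partialColumns n)
full-eq n =
  trans (diag-cong diag-σ n) (
  trans (diag-+ (λ _ _ → 1ℤ) _ n) (
  cong₂ _+_ (diag-1 n) (
  trans (diag-+ (λ a → X (partialSums (λ i → diag (σ i)) a)) _ n)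
        (cong₂ _+_ (diag-X (partialSums (λ i → diag (σ i))) n)
                   (diag-X (λ a → diag (partialSums (σ a))) n)))))

partialColumns-eq : ∀ n → partialColumns n ≡ full n + X partialColumns n
partialColumns-eq n =
  trans (diag-cong (λ a → diag-partialSums (σ a)) n) (
  trans (diag-+ (λ a → diag (σ a)) _ n)
        (cong (_+_ (full n)) (diag-X (λ a → diag (partialSums (σ a))) n)))

partialRows≡partialColumns : partialRows ≗ partialColumns
partialRows≡partialColumns zero    = trans (diag-partialSums (λ a → diag (σ a)) 0)
  (sym (partialColumns-eq 0))
partialRows≡partialColumns (suc n) = trans (diag-partialSums (λ a → diag (σ a)) (suc n))
  (trans (cong (_+_ (full (suc n))) (partialRows≡partialColumns n)) (sym (partialColumns-eq (suc n))))

full-rec : ∀ n → full (suc (suc n)) ≡ + 3 * full (suc n) + 1ℤ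
full-rec n = lemma (+ suc n) (full (suc (suc n))) (full (suc n)) _ _ _ _
  (full-eq (suc (suc n))) (full-eq (suc n)) (partialColumns-eq (suc n))
  (partialRows≡partialColumns (suc n)) (partialRows≡partialColumns n)
  where
  lemma : ∀ k r₂ r₁ v₁ v₀ w₁ w₀ → r₂ ≡ 1ℤ + (1ℤ + k) + (v₁ + w₁) → r₁ ≡ 1ℤ + k + (v₀ + w₀) →
    w₁ ≡ r₁ + w₀ → v₁ ≡ w₁ → v₀ ≡ w₀ → r₂ ≡ + 3 * r₁ + 1ℤ
  lemma k _ _ _ _ _ w₀ refl refl refl refl refl = identity k w₀
    where
    identity : ∀ k w → 1ℤ + (1ℤ + k) + ((1ℤ + k + (w + w)) + w + ((1ℤ + k + (w + w)) + w))
      ≡ + 3 * (1ℤ + k + (w + w)) + 1ℤ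
    identity = solve-∀

β-eq : ∀ n → β n ≡ full (suc n) - edge (suc n)
-- The `refl` splits the row a = 0 off the double sum: `full` is `edge` plus x times `β`.
β-eq n = lemma (edge (suc n)) (β n) (full (suc n)) refl
  where
  lemma : ∀ x y z → z ≡ x + y → y ≡ z - x
  lemma x y _ refl = identity x y
    where
    identity : ∀ x y → y ≡ x + y - x
    identity = solve-∀

-- The factor (1-x)(1-2x) = 1-3x+2x² differs from the recurrences of `full` and `edge` only in
-- low-order terms: it leaves `1ℤ + + 2 * full` of the one and `edge` of the other.
φ-step : ∀ n → φ (suc (suc n)) ≡ + 3 * φ (suc n) - φ n + (1ℤ + + 2 * full (suc n) - edge (suc n))
φ-step n = lemma (φ (suc (suc n))) (φ (suc n)) (φ n) (β (suc (suc n))) (β (suc n)) (β n)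
  (full (suc (suc (suc n)))) (full (suc (suc n))) (full (suc n))
  (edge (suc (suc (suc n)))) (edge (suc (suc n))) (edge (suc n))
  (φ-rec (suc (suc n))) (β-eq (suc (suc n))) (β-eq (suc n)) (β-eq n)
  (full-rec (suc n)) (edge-rec (suc n))
  where
  lemma : ∀ f₂ f₁ f₀ b₂ b₁ b₀ r₃ r₂ r₁ s₃ s₂ s₁ →
    f₂ ≡ + 3 * f₁ + - + 1 * f₀ + (b₂ + - + 3 * b₁ + + 2 * b₀) →
    b₂ ≡ r₃ - s₃ → b₁ ≡ r₂ - s₂ → b₀ ≡ r₁ - s₁ → r₃ ≡ + 3 * r₂ + 1ℤ → s₃ ≡ + 3 * s₂ - s₁ →
    f₂ ≡ + 3 * f₁ - f₀ + (1ℤ + + 2 * r₁ - s₁)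
  lemma _ f₁ f₀ _ _ _ _ r₂ r₁ _ s₂ s₁ refl refl refl refl refl refl = identity f₁ f₀ r₂ r₁ s₂ s₁
    where
    identity : ∀ f₁ f₀ r₂ r₁ s₂ s₁ →
      + 3 * f₁ + - + 1 * f₀
        + (+ 3 * r₂ + 1ℤ - (+ 3 * s₂ - s₁) + - + 3 * (r₂ - s₂) + + 2 * (r₁ - s₁))
      ≡ + 3 * f₁ - f₀ + (1ℤ + + 2 * r₁ - s₁)
    identity = solve-∀

-- Each step raises `k` and lowers `d`, so the recursion runs along an anti-diagonal and collects
-- each `h k d` on the next lower one once.
unfold-anti-diagonals : ∀ (u h : ℕ → PowerSeries) → (∀ k → u k 0 ≡ 1ℤ) →
  (∀ k d → u k (suc d) ≡ u (suc k) d + h k d) → ∀ n → u 0 n ≡ 1ℤ + X (diag h) n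
unfold-anti-diagonals u h u₀ uₛ zero    = u₀ 0
unfold-anti-diagonals u h u₀ uₛ (suc n) =
  trans (uₛ 0 n) (
  trans (cong (_+ h 0 n) (unfold-anti-diagonals (λ k → u (suc k)) (λ k → h (suc k))
          (λ k → u₀ (suc k)) (λ k → uₛ (suc k)) n))
  (trans (lemma _ (h 0 n)) (cong (_+_ 1ℤ) (sym (diag-peel h n)))))
  where
  lemma : ∀ x y → 1ℤ + x + y ≡ 1ℤ + (y + x)
  lemma = solve-∀

-- F = 1/(1-x) + x²φ: one x stems from the insertion that creates the first ascent, the other from
-- `split 0` being zero.
decreasing-eq : ∀ n → decreasing 0 (suc (suc n)) ≡ 1ℤ + φ n
decreasing-eq n = trans
  (unfold-anti-diagonals decreasing split (λ _ → refl) (λ _ _ → refl) (suc (suc n)))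
  (cong (_+_ 1ℤ) (trans (ℤ.+-identityˡ _) (diag-assoc (λ a c → plain (suc a) (suc c) 0) n)))

-- Clearing the denominator

conv : List ℤ → PowerSeries → PowerSeries
conv []       f n = 0ℤ
conv (a ∷ as) f n = X (conv as f) n + f n * a

-- The last summand pairs `f n` with the constant coefficient; the others form the product with the
-- tail, one degree lower.
⊛-poly : ∀ f as n → (f ⊛ poly as) n ≡ conv as f n
⊛-poly f []       n = trans (sum-cong-≗ {suc n} (λ i → ℤ.*-zeroʳ (f (toℕ i)))) (sum-replicate-zero (suc n))
⊛-poly f (a ∷ as) n = trans
  (sum-init-last {n} (λ i → f (toℕ i) * poly (a ∷ as) (n ∸ toℕ i)))
  (cong₂ _+_ (initial n) last-term)
  where
  last-term : f (toℕ (fromℕ n)) * poly (a ∷ as) (n ∸ toℕ (fromℕ n)) ≡ f n * a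
  last-term rewrite Fin.toℕ-fromℕ n | ℕ.n∸n≡0 n = refl

  initial : ∀ n → sum {n} (λ i → f (toℕ (inject₁ i)) * poly (a ∷ as) (n ∸ toℕ (inject₁ i)))
    ≡ X (conv as f) n
  initial zero    = refl
  initial (suc n) = trans (sum-cong-≗ {suc n} term) (⊛-poly f as n)
    where
    term : ∀ (i : Fin (suc n)) → f (toℕ (inject₁ i)) * poly (a ∷ as) (suc n ∸ toℕ (inject₁ i))
      ≡ f (toℕ i) * poly as (n ∸ toℕ i)
    term i rewrite Fin.toℕ-inject₁ i | ℕ.+-∸-assoc 1 (Fin.toℕ≤pred[n] i) = refl

⊛-cong : ∀ {f f′ g g′} → f ≗ f′ → g ≗ g′ → f ⊛ g ≗ f′ ⊛ g′
⊛-cong f≗ g≗ n = sum-cong-≗ {suc n} (λ i → cong₂ _*_ (f≗ (toℕ i)) (g≗ (n ∸ toℕ i)))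

linear₃ linear₁ quadratic : PowerSeries
linear₃   = poly (+ 1 ∷ - + 3 ∷ [])
linear₁   = poly (+ 1 ∷ - + 1 ∷ [])
quadratic = poly (+ 1 ∷ - + 3 ∷ + 1 ∷ [])

denominator : List ℤ
denominator = + 1 ∷ - + 10 ∷ + 38 ∷ - + 68 ∷ + 58 ∷ - + 22 ∷ + 3 ∷ []

denominator-eq : linear₃ ⊛ linear₁ ⊛ (quadratic ⊛ quadratic) ≗ poly denominator
denominator-eq n = trans (⊛-cong left right n) (trans
  (⊛-poly (poly (+ 1 ∷ - + 4 ∷ + 3 ∷ [])) (+ 1 ∷ - + 6 ∷ + 11 ∷ - + 6 ∷ + 1 ∷ []) n) (product n))
  where
  left : linear₃ ⊛ linear₁ ≗ poly (+ 1 ∷ - + 4 ∷ + 3 ∷ [])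
  left n = trans (⊛-poly linear₃ (+ 1 ∷ - + 1 ∷ []) n) (expand n)
    where
    expand : conv (+ 1 ∷ - + 1 ∷ []) linear₃ ≗ poly (+ 1 ∷ - + 4 ∷ + 3 ∷ [])
    expand 0 = refl
    expand 1 = refl
    expand 2 = refl
    expand (suc (suc (suc n))) = refl
  right : quadratic ⊛ quadratic ≗ poly (+ 1 ∷ - + 6 ∷ + 11 ∷ - + 6 ∷ + 1 ∷ [])
  right n = trans (⊛-poly quadratic (+ 1 ∷ - + 3 ∷ + 1 ∷ []) n) (expand n)
    where
    expand : conv (+ 1 ∷ - + 3 ∷ + 1 ∷ []) quadratic ≗ poly (+ 1 ∷ - + 6 ∷ + 11 ∷ - + 6 ∷ + 1 ∷ [])
    expand 0 = refl
    expand 1 = refl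
    expand 2 = refl
    expand 3 = refl
    expand 4 = refl
    expand (suc (suc (suc (suc (suc n))))) = refl
  product : conv (+ 1 ∷ - + 6 ∷ + 11 ∷ - + 6 ∷ + 1 ∷ []) (poly (+ 1 ∷ - + 4 ∷ + 3 ∷ []))
    ≗ poly denominator
  product 0 = refl
  product 1 = refl
  product 2 = refl
  product 3 = refl
  product 4 = refl
  product 5 = refl
  product 6 = refl
  product (suc (suc (suc (suc (suc (suc (suc n))))))) = refl

-- The power 3ⁿ⁺², because the coefficients of `full` are (3ⁿ⁺¹ - 1)/2.
tripled : PowerSeries
tripled n = 1ℤ + + 2 * full (suc n)

edge⁺ : PowerSeries
edge⁺ n = edge (suc n)

tripled-step : ∀ n → tripled (suc n) ≡ + 3 * tripled n
tripled-step n = trans (cong (λ r → 1ℤ + + 2 * r) (full-rec n)) (lemma (full (suc n)))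
  where
  lemma : ∀ r → 1ℤ + + 2 * (+ 3 * r + 1ℤ) ≡ + 3 * (1ℤ + + 2 * r)
  lemma = solve-∀

-- The denominator is (1 - 3x + x²)(1 - 7x + 16x² - 13x³ + 3x⁴).
factor : ∀ f₀ f₁ f₂ f₃ f₄ f₅ f₆ →
  0ℤ + (1ℤ + f₀) * + 3 + (1ℤ + f₁) * - + 22 + (1ℤ + f₂) * + 58 + (1ℤ + f₃) * - + 68
    + (1ℤ + f₄) * + 38 + (1ℤ + f₅) * - + 10 + (1ℤ + f₆) * + 1
  ≡ (f₆ - (+ 3 * f₅ - f₄)) - + 7 * (f₅ - (+ 3 * f₄ - f₃)) + + 16 * (f₄ - (+ 3 * f₃ - f₂))
    - + 13 * (f₃ - (+ 3 * f₂ - f₁)) + + 3 * (f₂ - (+ 3 * f₁ - f₀))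
factor = solve-∀

residual : ∀ n → φ (suc (suc n)) - (+ 3 * φ (suc n) - φ n) ≡ tripled n - edge⁺ n
residual n = trans (cong (_- (+ 3 * φ (suc n) - φ n)) (φ-step n))
  (lemma (+ 3 * φ (suc n) - φ n) (tripled n) (edge⁺ n))
  where
  lemma : ∀ y t s → y + (t - s) - y ≡ t - s
  lemma = solve-∀

-- The quartic 1-7x+16x²-13x³+3x⁴ is (1-x)(1-3x)(1-3x+x²): its factor 1-3x kills the powers of
-- three, its factor 1-3x+x² the coefficients of `edge`.
vanish : ∀ t₀ t₁ t₂ t₃ t₄ s₀ s₁ s₂ s₃ s₄ →
  t₄ ≡ + 3 * t₃ → t₃ ≡ + 3 * t₂ → t₂ ≡ + 3 * t₁ → t₁ ≡ + 3 * t₀ →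
  s₄ ≡ + 3 * s₃ - s₂ → s₃ ≡ + 3 * s₂ - s₁ → s₂ ≡ + 3 * s₁ - s₀ →
  (t₄ - s₄) - + 7 * (t₃ - s₃) + + 16 * (t₂ - s₂) - + 13 * (t₁ - s₁) + + 3 * (t₀ - s₀) ≡ 0ℤ
vanish t _ _ _ _ r s _ _ _ refl refl refl refl refl refl refl = identity t r s
  where
  identity : ∀ t r s →
    (+ 3 * (+ 3 * (+ 3 * (+ 3 * t))) - (+ 3 * (+ 3 * (+ 3 * s - r) - s) - (+ 3 * s - r)))
    - + 7 * (+ 3 * (+ 3 * (+ 3 * t)) - (+ 3 * (+ 3 * s - r) - s))
    + + 16 * (+ 3 * (+ 3 * t) - (+ 3 * s - r)) - + 13 * (+ 3 * t - s) + + 3 * (t - r) ≡ 0ℤ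
  identity = solve-∀

-- The constant 1 in `decreasing-eq` cancels because the denominator is divisible by 1-x. One factor
-- 1-3x+x² turns φ into `tripled` minus `edge⁺`, and the quartic cofactor kills this difference.
numerator-high : ∀ n →
  conv denominator (decreasing 0) (suc (suc (suc (suc (suc (suc (suc (suc n)))))))) ≡ 0ℤ
numerator-high n = trans
  (cong₇ (decreasing-eq n) (decreasing-eq (1 ℕ.+ n)) (decreasing-eq (2 ℕ.+ n)) (decreasing-eq (3 ℕ.+ n))
    (decreasing-eq (4 ℕ.+ n)) (decreasing-eq (5 ℕ.+ n)) (decreasing-eq (6 ℕ.+ n)))
  (trans (factor (φ n) (φ (1 ℕ.+ n)) (φ (2 ℕ.+ n)) (φ (3 ℕ.+ n)) (φ (4 ℕ.+ n)) (φ (5 ℕ.+ n)) (φ (6 ℕ.+ n)))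
  (trans (cong₅ (residual (4 ℕ.+ n)) (residual (3 ℕ.+ n)) (residual (2 ℕ.+ n))
    (residual (1 ℕ.+ n)) (residual n))
  (vanish (tripled n) (tripled (1 ℕ.+ n)) (tripled (2 ℕ.+ n)) (tripled (3 ℕ.+ n)) (tripled (4 ℕ.+ n))
    (edge⁺ n) (edge⁺ (1 ℕ.+ n)) (edge⁺ (2 ℕ.+ n)) (edge⁺ (3 ℕ.+ n)) (edge⁺ (4 ℕ.+ n))
    (tripled-step (3 ℕ.+ n)) (tripled-step (2 ℕ.+ n)) (tripled-step (1 ℕ.+ n)) (tripled-step n)
    (edge-rec (3 ℕ.+ n)) (edge-rec (2 ℕ.+ n)) (edge-rec (1 ℕ.+ n)))))
  where
  cong₇ : ∀ {a₀ a₁ a₂ a₃ a₄ a₅ a₆ b₀ b₁ b₂ b₃ b₄ b₅ b₆} →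
    a₀ ≡ b₀ → a₁ ≡ b₁ → a₂ ≡ b₂ → a₃ ≡ b₃ → a₄ ≡ b₄ → a₅ ≡ b₅ → a₆ ≡ b₆ →
    0ℤ + a₀ * + 3 + a₁ * - + 22 + a₂ * + 58 + a₃ * - + 68 + a₄ * + 38 + a₅ * - + 10 + a₆ * + 1
    ≡ 0ℤ + b₀ * + 3 + b₁ * - + 22 + b₂ * + 58 + b₃ * - + 68 + b₄ * + 38 + b₅ * - + 10 + b₆ * + 1
  cong₇ refl refl refl refl refl refl refl = refl
  cong₅ : ∀ {a₀ a₁ a₂ a₃ a₄ b₀ b₁ b₂ b₃ b₄} → a₀ ≡ b₀ → a₁ ≡ b₁ → a₂ ≡ b₂ → a₃ ≡ b₃ → a₄ ≡ b₄ →
    a₀ - + 7 * a₁ + + 16 * a₂ - + 13 * a₃ + + 3 * a₄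
    ≡ b₀ - + 7 * b₁ + + 16 * b₂ - + 13 * b₃ + + 3 * b₄
  cong₅ refl refl refl refl refl = refl

-- `decreasing-eq` starts at index 2 and the denominator has degree 6, so the recurrences take over
-- at degree 8; evaluation settles the lower degrees.
numerator-eq : conv denominator (decreasing 0)
  ≗ poly (+ 1 ∷ - + 9 ∷ + 30 ∷ - + 44 ∷ + 27 ∷ - + 7 ∷ [])
numerator-eq 0 = refl
numerator-eq 1 = refl
numerator-eq 2 = refl
numerator-eq 3 = refl
numerator-eq 4 = refl
numerator-eq 5 = refl
numerator-eq 6 = refl
numerator-eq 7 = refl
numerator-eq (suc (suc (suc (suc (suc (suc (suc (suc n)))))))) = numerator-high n

theorem10 :
  let T  = (1 ∷ 2 ∷ 4 ∷ 3 ∷ []) ∷ (3 ∷ 1 ∷ 4 ∷ 2 ∷ []) ∷ (3 ∷ 4 ∷ 1 ∷ 2 ∷ []) ∷ []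
      1-3x    = poly (+ 1 ∷ - + 3 ∷ [])
      1-x     = poly (+ 1 ∷ - + 1 ∷ [])
      1-3x+x² = poly (+ 1 ∷ - + 3 ∷ + 1 ∷ [])
  in F T ⊛ (1-3x ⊛ 1-x ⊛ (1-3x+x² ⊛ 1-3x+x²))
     ≗ poly (+ 1 ∷ - + 9 ∷ + 30 ∷ - + 44 ∷ + 27 ∷ - + 7 ∷ [])
theorem10 n = trans (⊛-cong F-eq denominator-eq n)
  (trans (⊛-poly (decreasing 0) denominator n) (numerator-eq n))
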